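{- Let $\mathcal{B}=[0,1]^2$ and let $\mathbb{P}$ have moves $\mathbf{m}_1=(c_1,d_1)$, $\mathbf{m}_2=(c_2,d_2)$ satisfying $0<\frac{d_1}{c_1}<1<\frac{d_2}{c_2}$. Then the denominator of $([0,1]^{2q},\mathcal{A}_{\mathbb{P}}^q)$ is the least common multiple of the denominators of the first $q$ terms of the sequence defined for $i\ge1$ by \[\begin{cases}\left(1,\left(\frac{d_1c_2}{c_1d_2}\right)^{\frac{i-1}{2}}\right) & i\text{ odd},\\ \left(\frac{d_1}{c_1}\left(\frac{d_1c_2}{c_1d_2}\right)^{\frac i2-1},\ \frac{c_2}{d_2}\left(\frac{d_1c_2}{c_1d_2}\right)^{\frac i2-1}\right) & i\text{ even},\end{cases}\] and the denominators of the first $\lfloor (q-1)/2\rfloor$ terms of the sequence defined for $i\ge1$ by \[\begin{cases}\left(\frac{d_1c_2}{c_1d_2}\right)^{\frac{i-1}{2}}\left(\frac{c_2(d_1-c_1)}{c_1d_2-c_2d_1},\ \frac{d_1(d_2-c_2)}{c_1d_2-c_2d_1}\right) & i\text{ odd},\\ \left(\frac{d_1c_2}{c_1d_2}\right)^{\frac i2}\left(\frac{c_1(c_2-d_2)}{c_1d_2-c_2d_1},\ \frac{d_2(c_1-d_1)}{c_1d_2-c_2d_1}\right) & i\text{ even}.\end{cases}\]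
   Context: $\mathbb{P}$ is a two-move rider: its basic moves $\mathbf{m}_1,\mathbf{m}_2$ are nonparallel vectors with relatively prime integer coordinates. For $\mathbf{z}=(\mathbf{z}_1,\dots,\mathbf{z}_q)\in\mathbb{R}^{2q}$, attack equations are the hyperplanes $(\mathbf{z}_i-\mathbf{z}_j)\cdot(d_r,-c_r)=0$ for $i\ne j$, $r\in\{1,2\}$, forming the arrangement $\mathcal{A}_{\mathbb{P}}^q$; fixations are the hyperplanes $x_i=0$, $x_i=1$, $y_i=0$, $y_i=1$ where $\mathbf{z}_i=(x_i,y_i)$. A vertex of the inside-out polytope $([0,1]^{2q},\mathcal{A}_{\mathbb{P}}^q)$ is a point of $[0,1]^{2q}$ that is the unique common point of some collection of attack equations and fixations. The denominator of a rational point is the lcm of the denominators of its coordinates, and the denominator of the inside-out polytope is the lcm of the denominators of all its vertices. -}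

module Defs where

open import Data.Nat using (ℕ; zero; suc; _∸_)
open import Data.Nat.Divisibility using (_∣_)
import Data.Nat as ℕ
open import Data.Nat.LCM using (lcm)
open import Data.Integer using (ℤ)
open import Data.Rational using (ℚ; 0ℚ; 1ℚ; _+_; _-_; _*_; _÷_; _≤_; _≟_)
import Data.Rational as ℚ
open ℚ.ℚ using (denominatorℕ)
open import Data.Fin using (Fin)
open import Data.Bool using (Bool; true; false)
open import Data.Product using (_×_; _,_; proj₁; proj₂; Σ; ∃)
open import Data.List using (List; []; _∷_; map; foldr)
open import Data.List.Relation.Unary.All using (All)
open import Relation.Binary.PropositionalEquality using (_≡_; _≢_)
open import Relation.Nullary using (yes; no)

⟦_⟧ : ℤ → ℚ
⟦ z ⟧ = ℚ._/_ z 1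

-- total division on ℚ (x / 0 := 0); only ever applied to nonzero divisors
-- under the hypotheses of the theorem
_/'_ : ℚ → ℚ → ℚ
p /' q with q ≟ 0ℚ
... | yes _ = 0ℚ
... | no q≢0 = _÷_ p q {{ℚ.≢-nonZero q≢0}}

infixl 7 _/'_

_^'_ : ℚ → ℕ → ℚ
p ^' zero = 1ℚ
p ^' suc n = p * (p ^' n)

Pt : Set
Pt = ℚ × ℚ

denPt : Pt → ℕ
denPt (x , y) = lcm (denominatorℕ x) (denominatorℕ y)

lcmList : List ℕ → ℕ
lcmList = foldr lcm 1

range1 : ℕ → List ℕ
range1 zero = []
range1 (suc n) = foldr _∷_ (suc n ∷ []) (range1 n)

record Moves : Set where
  constructor moves
  field
    c₁ d₁ c₂ d₂ : ℤ

module _ (P : Moves) where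
  open Moves P

  ratio : ℚ
  ratio = (⟦ d₁ ⟧ * ⟦ c₂ ⟧) /' (⟦ c₁ ⟧ * ⟦ d₂ ⟧)

  Δ : ℚ
  Δ = ⟦ c₁ ⟧ * ⟦ d₂ ⟧ - ⟦ c₂ ⟧ * ⟦ d₁ ⟧

  scale : ℚ → Pt → Pt
  scale a (x , y) = (a * x , a * y)

  -- select the i-th term (i ≥ 1) of a sequence given by its odd terms
  -- (i = 2k+1 ↦ odd k) and its even terms (i = 2k+2 ↦ even k)
  byParity : (ℕ → Pt) → (ℕ → Pt) → ℕ → Pt
  byParity odd even i = go i 0
    where
    go : ℕ → ℕ → Pt
    go zero k = (0ℚ , 0ℚ)   -- index 0: unused
    go (suc zero) k = odd k
    go (suc (suc zero)) k = even k
    go (suc (suc (suc j))) k = go (suc j) (suc k)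

  seqA : ℕ → Pt
  seqA = byParity (λ k → (1ℚ , ratio ^' k))
                  (λ k → scale (ratio ^' k) (⟦ d₁ ⟧ /' ⟦ c₁ ⟧ , ⟦ c₂ ⟧ /' ⟦ d₂ ⟧))

  seqB : ℕ → Pt
  seqB = byParity
    (λ k → scale (ratio ^' k)
      ( (⟦ c₂ ⟧ * (⟦ d₁ ⟧ - ⟦ c₁ ⟧)) /' Δ
      , (⟦ d₁ ⟧ * (⟦ d₂ ⟧ - ⟦ c₂ ⟧)) /' Δ ))
    (λ k → scale (ratio ^' suc k)
      ( (⟦ c₁ ⟧ * (⟦ c₂ ⟧ - ⟦ d₂ ⟧)) /' Δ
      , (⟦ d₂ ⟧ * (⟦ c₁ ⟧ - ⟦ d₁ ⟧)) /' Δ ))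

  seqLcm : ℕ → ℕ
  seqLcm q = lcm (lcmList (map (λ i → denPt (seqA i)) (range1 q)))
                 (lcmList (map (λ i → denPt (seqB i)) (range1 ((q ∸ 1) ℕ./ 2))))

  Config : ℕ → Set
  Config q = Fin q → Pt

  data Hyp (q : ℕ) : Set where
    attack : (i j : Fin q) → i ≢ j → (r : Fin 2) → Hyp q
    fixX   : Fin q → Bool → Hyp q
    fixY   : Fin q → Bool → Hyp q

  move : Fin 2 → ℤ × ℤ
  move Fin.zero = (c₁ , d₁)
  move (Fin.suc _) = (c₂ , d₂)

  b2q : Bool → ℚ
  b2q false = 0ℚ
  b2q true = 1ℚ

  OnHyp : ∀ {q} → Config q → Hyp q → Set
  OnHyp z (attack i j _ r) =
    let (c , d) = move r in
    (proj₁ (z i) - proj₁ (z j)) * ⟦ d ⟧ - (proj₂ (z i) - proj₂ (z j)) * ⟦ c ⟧ ≡ 0ℚ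
  OnHyp z (fixX i b) = proj₁ (z i) ≡ b2q b
  OnHyp z (fixY i b) = proj₂ (z i) ≡ b2q b

  InBox : ∀ {q} → Config q → Set
  InBox {q} z = (i : Fin q) →
    (0ℚ ≤ proj₁ (z i)) × (proj₁ (z i) ≤ 1ℚ) × (0ℚ ≤ proj₂ (z i)) × (proj₂ (z i) ≤ 1ℚ)

  -- vertex of the inside-out polytope ([0,1]^{2q}, A_P^q): a point of the
  -- cube that is the unique common point of some collection of hyperplanes
  IsVertex : ∀ {q} → Config q → Set
  IsVertex {q} z = InBox z × Σ (List (Hyp q)) λ S →
    All (OnHyp z) S × ((w : Config q) → All (OnHyp w) S → (i : Fin q) → w i ≡ z i)

  denConfig : ∀ {q} → Config q → ℕ
  denConfig {zero} z = 1
  denConfig {suc q} z = lcm (denPt (z Fin.zero)) (denConfig {q} (λ i → z (Fin.suc i)))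

  -- D is the denominator of the inside-out polytope, i.e. the lcm of the
  -- denominators of all its vertices
  IsIOPDenominator : ℕ → ℕ → Set
  IsIOPDenominator q D =
    ((z : Config q) → IsVertex z → denConfig z ∣ D) ×
    ((n : ℕ) → ((z : Config q) → IsVertex z → denConfig z ∣ n) → D ∣ n)

{-# OPTIONS --safe #-}

-- Put a = d₁/c₁, b = c₂/d₂, r = a b and use the coordinate 1 − x, so that pieces
-- attack each other along the lines y + a x = const and x + b y = const. A piece
-- on a side of the square ties the line of one kind through it to the line of
-- the other kind, and a configuration is a vertex only if no nonzero
-- displacement of the lines respects these ties. A trajectory of lines bouncing
-- in the square contracts by r towards (0,0) or (1,1) every two bounces, so
-- displacing each of its lines proportionally to its distance from that corner
-- respects all ties beyond a missing piece. Hence every line of a vertex is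
-- joined to (1,0) or (0,1) by pieces at all bounces in between: up to the
-- central symmetry its constant is a term of 1, a, a b, a² b, … (or of 1, b, a
-- b, a b², …), and the index of the term counts those pieces. Two such lines
-- meet inside the square only on a side, which gives the first sequence, or when
-- their indices agree, n say; then 2n + 1 pieces are used, which gives the
-- second sequence. Conversely pieces placed at consecutive bounces, and at such
-- a meeting point, form vertices.

module Submission where

open import Defs
open import Data.Nat using (ℕ; zero; suc; s≤s; z≤n; _∸_)
import Data.Nat as ℕ
import Data.Nat.Properties as ℕ
import Data.Nat.DivMod as ℕ
open import Data.Nat.Coprimality using (Coprime)
open import Data.Nat.Divisibility using (_∣_; divides; 1∣_; ∣-trans)
open import Data.Nat.LCM using (lcm; lcm-least; m∣lcm[m,n]; n∣lcm[m,n])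
open import Data.Integer using (ℤ; ∣_∣; +_; -[1+_])
import Data.Integer as Int
import Data.Integer.Properties as Int
import Data.Integer.GCD as Int
open import Data.Rational hiding (∣_∣; _≃_)
open import Data.Rational.Properties
import Data.Rational.Unnormalised as ℚᵘ
import Data.Rational.Unnormalised.Properties as ℚᵘ
open import Data.Bool using (Bool; true; false)
open import Data.Empty using (⊥; ⊥-elim)
open import Data.Fin as Fin using (Fin; toℕ; fromℕ<)
open import Data.Fin.Properties using (any?; injective⇒≤; toℕ-fromℕ<; toℕ<n)
open import Data.List as List using (List; []; _∷_; map; foldr; length; lookup; concat; tabulate)
open import Data.List.Properties using (length-map)
open import Data.List.Membership.Propositional.Properties using (∈-lookup)
open import Data.List.Relation.Unary.All as All using (All; []; _∷_)
import Data.List.Relation.Unary.All.Properties as All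
open import Data.List.Relation.Unary.AllPairs using ([]; _∷_)
open import Data.List.Relation.Unary.Unique.Propositional using (Unique)
import Data.List.Relation.Unary.Unique.Propositional.Properties as Unique
open import Data.Maybe using (Maybe; just; nothing)
open import Data.Product using (_×_; _,_; proj₁; proj₂; ∃; swap)
open import Data.Sum using (_⊎_; inj₁; inj₂)
open import Function using (_∘_)
open import Relation.Nullary using (¬_; Dec; yes; no)
open import Relation.Nullary.Decidable using (_×-dec_; map′)
open import Relation.Binary.Definitions using (Tri; tri<; tri≈; tri>)
open import Relation.Binary.PropositionalEquality
open import Tactic.RingSolver using (solve; solve-∀)
open import Tactic.RingSolver.Core.AlmostCommutativeRing using (AlmostCommutativeRing; fromCommutativeRing)

-- Ordered-field arithmetic of ℚ

ℚ-ring : AlmostCommutativeRing _ _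
ℚ-ring = fromCommutativeRing +-*-commutativeRing isZero
  where
  isZero : ∀ x → Maybe (0ℚ ≡ x)
  isZero x with 0ℚ ≟ x
  ... | yes e = just e
  ... | no  _ = nothing

opaque

  0≤+ : ∀ {p q} → 0ℚ ≤ p → 0ℚ ≤ q → 0ℚ ≤ p + q
  0≤+ = +-mono-≤

  0<+ : ∀ {p q} → 0ℚ < p → 0ℚ ≤ q → 0ℚ < p + q
  0<+ = +-mono-<-≤

  0≤* : ∀ {p q} → 0ℚ ≤ p → 0ℚ ≤ q → 0ℚ ≤ p * q
  0≤* {p} {q} 0≤p 0≤q =
    nonNegative⁻¹ (p * q) {{nonNeg*nonNeg⇒nonNeg p {{nonNegative 0≤p}} q {{nonNegative 0≤q}}}}

  0<* : ∀ {p q} → 0ℚ < p → 0ℚ < q → 0ℚ < p * q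
  0<* {p} {q} 0<p 0<q = positive⁻¹ (p * q) {{pos*pos⇒pos p {{positive 0<p}} q {{positive 0<q}}}}

  0<1 : 0ℚ < 1ℚ
  0<1 = positive⁻¹ 1ℚ

  p-q+q≡p : ∀ p q → p - q + q ≡ p
  p-q+q≡p = solve-∀ ℚ-ring

  p+q*0≡p : ∀ q p → p + q * 0ℚ ≡ p
  p+q*0≡p = solve-∀ ℚ-ring

  1-[1-p]≡p : ∀ p → 1ℚ - (1ℚ - p) ≡ p
  1-[1-p]≡p = solve-∀ ℚ-ring

  0≤⇒≤ : ∀ {p q} → 0ℚ ≤ q - p → p ≤ q
  0≤⇒≤ {p} {q} h = subst₂ _≤_ (+-identityˡ p) (p-q+q≡p q p) (+-monoˡ-≤ p h)

  0<⇒< : ∀ {p q} → 0ℚ < q - p → p < q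
  0<⇒< {p} {q} h = subst₂ _<_ (+-identityˡ p) (p-q+q≡p q p) (+-monoˡ-< p h)

  ≤⇒0≤ : ∀ {p q} → p ≤ q → 0ℚ ≤ q - p
  ≤⇒0≤ {p} {q} h = subst (_≤ q - p) (+-inverseʳ p) (+-monoˡ-≤ (- p) h)

  <⇒0< : ∀ {p q} → p < q → 0ℚ < q - p
  <⇒0< {p} {q} h = subst (_< q - p) (+-inverseʳ p) (+-monoˡ-< (- p) h)

  ≤-by : ∀ {p q e} → 0ℚ ≤ e → e ≡ q - p → p ≤ q
  ≤-by h refl = 0≤⇒≤ h

  <-by : ∀ {p q e} → 0ℚ < e → e ≡ q - p → p < q
  <-by h refl = 0<⇒< h

  0<-by : ∀ {p e} → 0ℚ < e → e ≡ p → 0ℚ < p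
  0<-by h refl = h

  0<⇒≢0 : ∀ {p} → 0ℚ < p → p ≢ 0ℚ
  0<⇒≢0 h refl = <-irrefl refl h

  0<0-absurd : ∀ {e} {A : Set} → 0ℚ < e → e ≡ 0ℚ → A
  0<0-absurd h e = ⊥-elim (0<⇒≢0 h e)

  *-cancelˡ : ∀ c {p q} → c ≢ 0ℚ → c * p ≡ c * q → p ≡ q
  *-cancelˡ c {p} {q} c≢0 e = begin
    p                ≡⟨ expand p ⟨
    1/ c * (c * p)   ≡⟨ cong (1/ c *_) e ⟩
    1/ c * (c * q)   ≡⟨ expand q ⟩
    q                ∎
    where
    open ≡-Reasoning
    instance
      c-nonZero : NonZero c
      c-nonZero = ≢-nonZero c≢0
    expand : ∀ x → 1/ c * (c * x) ≡ x
    expand x = trans (sym (*-assoc (1/ c) c x)) (trans (cong (_* x) (*-inverseˡ c)) (*-identityˡ x))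

  *-cancelˡ-≤ : ∀ c {p q} → 0ℚ < c → c * p ≤ c * q → p ≤ q
  *-cancelˡ-≤ c 0<c = *-cancelˡ-≤-pos c {{positive 0<c}}

  0<^ : ∀ {r} k → 0ℚ < r → 0ℚ < r ^' k
  0<^ zero    0<r = 0<1
  0<^ (suc k) 0<r = 0<* 0<r (0<^ k 0<r)

  ^≤1 : ∀ {r} k → 0ℚ < r → r < 1ℚ → r ^' k ≤ 1ℚ
  ^≤1 zero 0<r r<1 = ≤-refl
  ^≤1 {r} (suc k) 0<r r<1 =
    ≤-by {e = (1ℚ - r) + r * (1ℚ - r ^' k)}
         (0≤+ (<⇒≤ (<⇒0< r<1)) (0≤* (<⇒≤ 0<r) (≤⇒0≤ (^≤1 k 0<r r<1))))
         (eq (r ^' k))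
    where
    eq : ∀ x → (1ℚ - r) + r * (1ℚ - x) ≡ 1ℚ - r * x
    eq x = solve (r List.∷ x List.∷ List.[]) ℚ-ring

nat : ℕ → ℚ
nat n = + n / 1

opaque

  nat-suc : ∀ n → nat (suc n) ≡ 1ℚ + nat n
  nat-suc n = toℚᵘ-injective (ℚᵘ.≃-trans (toℚᵘ-fromℚᵘ (ℚᵘ.mkℚᵘ (+ suc n) 0))
    (ℚᵘ.≃-sym (ℚᵘ.≃-trans (toℚᵘ-homo-+ 1ℚ (nat n))
      (ℚᵘ.≃-trans (ℚᵘ.+-congʳ ℚᵘ.1ℚᵘ (toℚᵘ-fromℚᵘ (ℚᵘ.mkℚᵘ (+ n) 0)))
        (ℚᵘ.*≡* (cong (λ m → (+ 1 Int.+ m) Int.* + 1) (Int.*-identityʳ (+ n))))))))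

  archimedean : ∀ p → ∃ λ n → p < nat n
  archimedean p@(mkℚ m d _) = suc Int.∣ m ∣ , toℚᵘ-cancel-<
    (ℚᵘ.<-respʳ-≃ (ℚᵘ.≃-sym (toℚᵘ-fromℚᵘ (ℚᵘ.mkℚᵘ (+ suc Int.∣ m ∣) 0))) (ℚᵘ.*<* m<bound))
    where
    open Int.≤-Reasoning
    m<bound : m Int.* + 1 Int.< + suc Int.∣ m ∣ Int.* + suc d
    m<bound = begin-strict
      m Int.* + 1                      ≡⟨ Int.*-identityʳ m ⟩
      m                                ≤⟨ i≤∣i∣ m ⟩
      + Int.∣ m ∣                      <⟨ Int.+<+ (ℕ.n<1+n _) ⟩
      + suc Int.∣ m ∣                  ≤⟨ Int.+≤+ (ℕ.m≤m*n (suc Int.∣ m ∣) (suc d)) ⟩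
      + (suc Int.∣ m ∣ ℕ.* suc d)      ≡⟨ Int.pos-* (suc Int.∣ m ∣) (suc d) ⟩
      + suc Int.∣ m ∣ Int.* + suc d    ∎
      where
      i≤∣i∣ : ∀ i → i Int.≤ + Int.∣ i ∣
      i≤∣i∣ (+ n) = Int.≤-refl
      i≤∣i∣ -[1+ n ] = Int.-≤+

  -- A reciprocal Bernoulli inequality, bounding `r ^' k` by a quantity of order `1/k`. The left
  -- side decreases in `k`: consecutive values differ by `r ^' k * (1 - r)² * (1 + k)`.
  bernoulli : ∀ {r} k → 0ℚ < r → r < 1ℚ → r ^' k * (1ℚ + nat k * (1ℚ - r)) ≤ 1ℚ
  bernoulli {r} zero 0<r r<1 = ≤-reflexive (solve (r List.∷ List.[]) ℚ-ring)
  bernoulli {r} (suc k) 0<r r<1 = ≤-trans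
    (≤-by {e = r ^' k * ((1ℚ - r) * (1ℚ - r) * (1ℚ + nat k))}
      (0≤* (<⇒≤ (0<^ k 0<r)) (0≤* (<⇒≤ (0<* (<⇒0< r<1) (<⇒0< r<1)))
        (0≤+ (<⇒≤ 0<1) (nonNegative⁻¹ (nat k) {{normalize-nonNeg k 1}}))))
      (trans (eq (r ^' k) (nat k)) (cong (λ n → r ^' k * (1ℚ + nat k * (1ℚ - r)) - r * r ^' k * (1ℚ + n * (1ℚ - r)))
         (sym (nat-suc k)))))
    (bernoulli k 0<r r<1)
    where
    eq : ∀ x n → x * ((1ℚ - r) * (1ℚ - r) * (1ℚ + n))
               ≡ x * (1ℚ + n * (1ℚ - r)) - r * x * (1ℚ + (1ℚ + n) * (1ℚ - r))
    eq x n = solve (r List.∷ x List.∷ n List.∷ List.[]) ℚ-ring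

  -- `n` exceeds `1 / ((1 - r) p)`, so `p (1 + n (1 - r)) > 1`; with `p ≤ r ^' n` this would
  -- contradict `bernoulli`.
  powers-vanish : ∀ {r p} → 0ℚ < r → r < 1ℚ → 0ℚ < p → ∃ λ n → r ^' n < p
  powers-vanish {r} {p} 0<r r<1 0<p = n , ≰⇒> λ p≤rⁿ →
    <-irrefl refl (<-≤-trans (<-≤-trans 1<np (mono p≤rⁿ)) (bernoulli n 0<r r<1))
    where
    0<c : 0ℚ < (1ℚ - r) * p
    0<c = 0<* (<⇒0< r<1) 0<p
    instance
      c-nonZero : NonZero ((1ℚ - r) * p)
      c-nonZero = ≢-nonZero (0<⇒≢0 0<c)
    i : ℚ
    i = 1/ ((1ℚ - r) * p)
    n : ℕ
    n = proj₁ (archimedean i)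
    0≤n : 0ℚ ≤ 1ℚ + nat n * (1ℚ - r)
    0≤n = 0≤+ (<⇒≤ 0<1) (0≤* (nonNegative⁻¹ (nat n) {{normalize-nonNeg n 1}}) (<⇒≤ (<⇒0< r<1)))
    mono : p ≤ r ^' n → p * (1ℚ + nat n * (1ℚ - r)) ≤ r ^' n * (1ℚ + nat n * (1ℚ - r))
    mono = *-monoʳ-≤-nonNeg _ {{nonNegative 0≤n}}
    expand : ∀ m j → (1ℚ - r) * p * j ≡ 1ℚ → p + (1ℚ - r) * p * (m - j) ≡ p * (1ℚ + m * (1ℚ - r)) - 1ℚ
    expand m j e = trans (lemma r p m j) (cong (λ x → p * (1ℚ + m * (1ℚ - r)) - x) e)
      where
      lemma : ∀ r p m j →
        p + (1ℚ - r) * p * (m - j) ≡ p * (1ℚ + m * (1ℚ - r)) - (1ℚ - r) * p * j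
      lemma = solve-∀ ℚ-ring
    1<np : 1ℚ < p * (1ℚ + nat n * (1ℚ - r))
    1<np = <-by (0<+ 0<p (<⇒≤ (0<* 0<c (<⇒0< (proj₂ (archimedean i))))))
      (expand (nat n) i (*-inverseʳ ((1ℚ - r) * p)))

-- Rigid configurations

-- `a` will be the slope of the first move, `b` the reciprocal slope of the second. In this form the
-- hypotheses are symmetric under exchange of coordinates, so a result for one kind of line
-- transfers to the other by `Slopes-swap`.
record Slopes (a b : ℚ) : Set where
  field
    0<a : 0ℚ < a
    a<1 : a < 1ℚ
    0<b : 0ℚ < b
    b<1 : b < 1ℚ

  opaque

    0<r : 0ℚ < a * b
    0<r = 0<* 0<a 0<b

    0<1-r : 0ℚ < 1ℚ - a * b
    0<1-r = 0<-by (0<+ (<⇒0< a<1) (0≤* (<⇒≤ 0<a) (<⇒≤ (<⇒0< b<1)))) (solve (a List.∷ b List.∷ List.[]) ℚ-ring)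

    r<1 : a * b < 1ℚ
    r<1 = 0<⇒< 0<1-r

Slopes-swap : ∀ {a b} → Slopes a b → Slopes b a
Slopes-swap S = record { 0<a = 0<b ; a<1 = b<1 ; 0<b = 0<a ; b<1 = a<1 }
  where open Slopes S

-- Serves both kinds of attack line: `line a p` is the constant of the first kind, `line b (swap p)`
-- that of the second.
line : ℚ → Pt → ℚ
line a (x , y) = y + a * x

centre : Pt → Pt
centre (x , y) = (1ℚ - x , 1ℚ - y)

line-centre : ∀ a p → line a (centre p) ≡ 1ℚ + a - line a p
line-centre a (x , y) = lemma a x y
  where
  lemma : ∀ a x y → (1ℚ - y) + a * (1ℚ - x) ≡ 1ℚ + a - (y + a * x)
  lemma = solve-∀ ℚ-ring

Unit : ℚ → Set
Unit x = 0ℚ ≤ x × x ≤ 1ℚ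

Unit-1- : ∀ {x} → Unit x → Unit (1ℚ - x)
Unit-1- {x} (0≤x , x≤1) = ≤⇒0≤ x≤1 , ≤-by 0≤x (solve (x List.∷ List.[]) ℚ-ring)

Box : Pt → Set
Box (x , y) = Unit x × Unit y

Edge : ℚ → Set
Edge x = x ≡ 0ℚ ⊎ x ≡ 1ℚ

-- An infinitesimal motion of the configuration that respects all attack
-- equations moves every line y + a x = u by some f u and every line
-- x + b y = v by some g v; the hypotheses say that pieces on a side of the
-- square stay on it.
Rigid : ℚ → ℚ → ∀ {q} → (Fin q → Pt) → Set
Rigid a b z = (f g : ℚ → ℚ) →
  (∀ i → Edge (proj₁ (z i)) → g (line b (swap (z i))) ≡ b * f (line a (z i))) →
  (∀ i → Edge (proj₂ (z i)) → f (line a (z i)) ≡ a * g (line b (swap (z i)))) →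
  ∀ i → f (line a (z i)) ≡ 0ℚ × g (line b (swap (z i))) ≡ 0ℚ

Rigid-swap : ∀ {a b q} {z : Fin q → Pt} → Rigid a b z → Rigid b a (swap ∘ z)
Rigid-swap R f g hx hy i = swap (R g f hy hx i)

-- The central symmetry sends the constants `u` and `v` to `1 + a - u` and `1 + b - v` and permutes
-- the sides. The ties are homogeneous, so `f` and `g` are reparametrised without a change of sign.
Rigid-centre : ∀ {a b q} {z : Fin q → Pt} → Rigid a b z → Rigid a b (centre ∘ z)
Rigid-centre {a} {b} {z = z} R f g hx hy i =
  trans (f≡ i) (proj₁ (result i)) , trans (g≡ i) (proj₂ (result i))
  where
  f≡ : ∀ i → f (line a (centre (z i))) ≡ f (1ℚ + a - line a (z i))
  f≡ i = cong f (line-centre a (z i))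
  g≡ : ∀ i → g (line b (swap (centre (z i)))) ≡ g (1ℚ + b - line b (swap (z i)))
  g≡ i = cong g (line-centre b (swap (z i)))
  Edge-1- : ∀ {x} → Edge x → Edge (1ℚ - x)
  Edge-1- (inj₁ refl) = inj₂ refl
  Edge-1- (inj₂ refl) = inj₁ refl
  result = R (λ u → f (1ℚ + a - u)) (λ v → g (1ℚ + b - v))
    (λ i e → trans (sym (g≡ i)) (trans (hx i (Edge-1- e)) (cong (b *_) (f≡ i))))
    (λ i e → trans (sym (f≡ i)) (trans (hy i (Edge-1- e)) (cong (a *_) (g≡ i))))

-- Motions along a trajectory

Orbit : ℚ → ℚ → ℚ → Set
Orbit r τ x = ∃ λ k → x ≡ τ * r ^' k

module _ {r : ℚ} (0<r : 0ℚ < r) (r<1 : r < 1ℚ) where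

  opaque

    Orbit-≤ : ∀ {τ x} → 0ℚ < τ → Orbit r τ x → x ≤ τ
    Orbit-≤ {τ} 0<τ (k , refl) =
      ≤-by {e = τ * (1ℚ - r ^' k)} (0≤* (<⇒≤ 0<τ) (≤⇒0≤ (^≤1 k 0<r r<1))) (lemma τ (r ^' k))
      where
      lemma : ∀ τ x → τ * (1ℚ - x) ≡ τ - τ * x
      lemma = solve-∀ ℚ-ring

    private
      -- `τ * r ^' n < x` leaves only the first `n` terms of the progression as candidates; each
      -- step compares `x` with the leading term.
      Orbit?-fuel : ∀ n {τ x} → 0ℚ < τ → τ * r ^' n < x → Dec (Orbit r τ x)
      Orbit?-fuel zero {τ} {x} 0<τ h =
        no λ o → <-irrefl refl (<-≤-trans (subst (_< x) (*-identityʳ τ) h) (Orbit-≤ 0<τ o))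
      Orbit?-fuel (suc n) {τ} {x} 0<τ h with x ≟ τ
      ... | yes refl = yes (0 , sym (*-identityʳ τ))
      ... | no x≢τ = map′ up down
        (Orbit?-fuel n (0<* 0<τ 0<r) (subst (_< x) (sym (*-assoc τ r (r ^' n))) h))
        where
        up : Orbit r (τ * r) x → Orbit r τ x
        up (k , e) = suc k , trans e (*-assoc τ r (r ^' k))
        down : Orbit r τ x → Orbit r (τ * r) x
        down (zero , e) = ⊥-elim (x≢τ (trans e (*-identityʳ τ)))
        down (suc k , e) = k , trans e (sym (*-assoc τ r (r ^' k)))

    Orbit? : ∀ {τ} → 0ℚ < τ → τ ≤ 1ℚ → ∀ x → Dec (Orbit r τ x)
    Orbit? {τ} 0<τ τ≤1 x with 0ℚ <? x
    ... | no 0≮x = no λ { (k , refl) → 0≮x (0<* 0<τ (0<^ k 0<r)) }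
    ... | yes 0<x with powers-vanish 0<r r<1 0<x
    ... | n , h = Orbit?-fuel n 0<τ (≤-<-trans
      (≤-by {e = (1ℚ - τ) * r ^' n} (0≤* (≤⇒0≤ τ≤1) (<⇒≤ (0<^ n 0<r))) (lemma τ (r ^' n))) h)
      where
      lemma : ∀ τ x → (1ℚ - τ) * x ≡ x - τ * x
      lemma = solve-∀ ℚ-ring

restrict : {A : Set} → Dec A → ℚ → ℚ
restrict (yes _) x = x
restrict (no _)  x = 0ℚ

restrict-yes : ∀ {A : Set} (d : Dec A) {x} → A → restrict d x ≡ x
restrict-yes (yes _) _ = refl
restrict-yes (no ¬p) p = ⊥-elim (¬p p)

restrict-no : ∀ {A : Set} (d : Dec A) {x} → ¬ A → restrict d x ≡ 0ℚ
restrict-no (yes p) ¬p = ⊥-elim (¬p p)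
restrict-no (no _)  _  = refl

restrict-⇔ : ∀ {A B : Set} (d : Dec A) (e : Dec B) → (A → B) → (B → A) →
  ∀ c x → restrict e (c * x) ≡ c * restrict d x
restrict-⇔ (yes p) e to from c x = restrict-yes e (to p)
restrict-⇔ (no ¬p) e to from c x = trans (restrict-no e (¬p ∘ from)) (sym (*-zeroʳ c))

-- The homothety about the origin, restricted to the lines on the trajectory
-- that starts with the line y + a x = τ and runs towards the origin.
module Tail {a b : ℚ} (S : Slopes a b) {τ : ℚ} (0<τ : 0ℚ < τ) (τ≤a : τ ≤ a) where
  open Slopes S

  opaque
    τ≤1 : τ ≤ 1ℚ
    τ≤1 = ≤-trans τ≤a (<⇒≤ a<1)

    bτ≤b : b * τ ≤ b
    bτ≤b = ≤-by (0≤* (<⇒≤ 0<b) (≤⇒0≤ τ≤1)) (solve (b List.∷ τ List.∷ List.[]) ℚ-ring)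

    bτ<1 : b * τ < 1ℚ
    bτ<1 = ≤-<-trans bτ≤b b<1

  private
    f-dec : ∀ u → Dec (Orbit (a * b) τ u)
    f-dec = Orbit? 0<r r<1 0<τ τ≤1

    g-dec : ∀ v → Dec (Orbit (a * b) (b * τ) v)
    g-dec = Orbit? 0<r r<1 (0<* 0<b 0<τ) (<⇒≤ bτ<1)

  opaque

    f g : ℚ → ℚ
    f u = restrict (f-dec u) u
    g v = restrict (g-dec v) v

    f-start : f τ ≡ τ
    f-start = restrict-yes (f-dec τ) (0 , sym (*-identityʳ τ))

    f-beyond : ∀ {u} → τ < u → f u ≡ 0ℚ
    f-beyond {u} τ<u = restrict-no (f-dec u)
      λ o → <-irrefl refl (<-≤-trans τ<u (Orbit-≤ 0<r r<1 0<τ o))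

    g-beyond : ∀ {v} → b * τ < v → g v ≡ 0ℚ
    g-beyond {v} h = restrict-no (g-dec v)
      λ o → <-irrefl refl (<-≤-trans h (Orbit-≤ 0<r r<1 (0<* 0<b 0<τ) o))

    on-x≡0 : ∀ y → g (b * y) ≡ b * f y
    on-x≡0 y = restrict-⇔ (f-dec y) (g-dec (b * y))
      (λ { (k , e) → k , trans (cong (b *_) e) (sym (*-assoc b τ _)) })
      (λ { (k , e) → k , *-cancelˡ b (0<⇒≢0 0<b) (trans e (*-assoc b τ _)) })
      b y

    -- The one failing tie is at the bounce `(τ / a , 0)` where the trajectory is cut: the line of
    -- the second kind through it precedes the trajectory and stays still, while `τ` moves.
    on-y≡0 : ∀ x → a * x ≢ τ → f (a * x) ≡ a * g x
    on-y≡0 x ax≢τ = restrict-⇔ (g-dec x) (f-dec (a * x)) to from a x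
      where
      lemma : ∀ a b τ p → a * (b * τ * p) ≡ τ * (a * b * p)
      lemma = solve-∀ ℚ-ring
      to : Orbit (a * b) (b * τ) x → Orbit (a * b) τ (a * x)
      to (k , e) = suc k , trans (cong (a *_) e) (lemma a b τ _)
      from : Orbit (a * b) τ (a * x) → Orbit (a * b) (b * τ) x
      from (zero , e) = ⊥-elim (ax≢τ (trans e (*-identityʳ τ)))
      from (suc k , e) = k , *-cancelˡ a (0<⇒≢0 0<a) (trans e (sym (lemma a b τ _)))

opaque

  -- Were the bounce where the tail is cut empty, the homothety of `Tail` would respect all ties and
  -- yet displace the line of piece `i` by `τ > 0`, against rigidity.
  tail-occupied : ∀ {a b q} {z : Fin q → Pt} → Slopes a b → Rigid a b z → (∀ i → Box (z i)) →
    ∀ i → 0ℚ < line a (z i) → line a (z i) ≤ a →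
    ∃ λ j → proj₂ (z j) ≡ 0ℚ × a * proj₁ (z j) ≡ line a (z i)
  tail-occupied {a} {b} {q} {z} S R box i 0<τ τ≤a
    with any? (λ j → (proj₂ (z j) ≟ 0ℚ) ×-dec (a * proj₁ (z j) ≟ line a (z i)))
  ... | yes found = found
  ... | no none = 0<0-absurd 0<τ (trans (sym f-start) (proj₁ (R f g hx hy i)))
    where
    open Slopes S
    open Tail S 0<τ τ≤a
    τ : ℚ
    τ = line a (z i)
    hx-pt : ∀ p → Box p → (proj₂ p ≡ 0ℚ × a * proj₁ p ≡ τ → ⊥) → Edge (proj₁ p) →
      g (line b (swap p)) ≡ b * f (line a p)
    hx-pt (x , y) _ _ (inj₁ refl) = trans (cong g (+-identityˡ (b * y)))
      (trans (on-x≡0 y) (cong (λ u → b * f u) (sym (p+q*0≡p a y))))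
    hx-pt (x , y) (_ , 0≤y , _) free (inj₂ refl) = trans (g-beyond (<-≤-trans bτ<1 1≤v))
      (sym (trans (cong (b *_) (f-beyond τ<u)) (*-zeroʳ b)))
      where
      1≤v : 1ℚ ≤ 1ℚ + b * y
      1≤v = ≤-by (0≤* (<⇒≤ 0<b) 0≤y) (solve (b List.∷ y List.∷ List.[]) ℚ-ring)
      a≤u : a ≤ y + a * 1ℚ
      a≤u = ≤-by 0≤y (solve (a List.∷ y List.∷ List.[]) ℚ-ring)
      τ<u : τ < y + a * 1ℚ
      τ<u with <-cmp τ (y + a * 1ℚ)
      ... | tri< h _ _ = h
      ... | tri> _ _ h = ⊥-elim (<-irrefl refl (<-≤-trans h (≤-trans τ≤a a≤u)))
      -- Equality forces `y = 0` and `τ = a`: the piece is at the corner `(1 , 0)`, which is then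
      -- itself the bounce assumed empty.
      ... | tri≈ _ h _ = ⊥-elim (free (y≡0 , trans (lemma a y y≡0) (sym h)))
        where
        y≡0 : y ≡ 0ℚ
        y≡0 = ≤-antisym (≤-by (≤⇒0≤ (subst (_≤ a) h τ≤a)) (solve (a List.∷ y List.∷ List.[]) ℚ-ring)) 0≤y
        lemma : ∀ a y → y ≡ 0ℚ → a * 1ℚ ≡ y + a * 1ℚ
        lemma a y refl = sym (+-identityˡ _)
    hy-pt : ∀ p → Box p → (proj₂ p ≡ 0ℚ × a * proj₁ p ≡ τ → ⊥) → Edge (proj₂ p) →
      f (line a p) ≡ a * g (line b (swap p))
    hy-pt (x , y) _ free (inj₁ refl) = trans (cong f (+-identityˡ (a * x)))
      (trans (on-y≡0 x λ e → free (refl , e)) (cong (λ u → a * g u) (sym (p+q*0≡p b x))))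
    hy-pt (x , y) ((0≤x , _) , _) _ (inj₂ refl) = trans (f-beyond τ<u)
      (sym (trans (cong (a *_) (g-beyond bτ<v)) (*-zeroʳ a)))
      where
      τ<u : τ < 1ℚ + a * x
      τ<u = ≤-<-trans τ≤a (<-≤-trans a<1 (≤-by (0≤* (<⇒≤ 0<a) 0≤x) (solve (a List.∷ x List.∷ List.[]) ℚ-ring)))
      bτ<v : b * τ < x + b * 1ℚ
      bτ<v = lemma τ (≤-<-trans τ≤a a<1)
        where
        lemma : ∀ τ → τ < 1ℚ → b * τ < x + b * 1ℚ
        lemma τ τ<1 = <-by (0<+ (0<* 0<b (<⇒0< τ<1)) 0≤x) (solve (b List.∷ τ List.∷ x List.∷ List.[]) ℚ-ring)
    hx : ∀ i → Edge (proj₁ (z i)) → g (line b (swap (z i))) ≡ b * f (line a (z i))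
    hx j = hx-pt (z j) (box j) (λ h → none (j , h))
    hy : ∀ i → Edge (proj₂ (z i)) → f (line a (z i)) ≡ a * g (line b (swap (z i)))
    hy j = hy-pt (z j) (box j) (λ h → none (j , h))

-- A line x + b y = σ joining the two horizontal sides continues to a
-- trajectory at either end; the motion is a homothety about (0,0) on one
-- continuation, about (1,1) on the other, with weights matching on the line σ.
module Crossing {a b : ℚ} (S : Slopes a b) where
  open Slopes S

  -- The bounds say that the line meets `y = 0` at `x = σ < 1` and `y = 1` at `x = σ - b > 0`. The
  -- tail opened here starts with the line of the first kind through the lower end, whose constant
  -- is `a * σ`.
  record Crosses (σ : ℚ) : Set where
    field
      b<σ : b < σ
      σ<1 : σ < 1ℚ
    opaque
      0<σ : 0ℚ < σ
      0<σ = <-trans 0<b b<σ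
      0<aσ : 0ℚ < a * σ
      0<aσ = 0<* 0<a 0<σ
      aσ<a : a * σ < a
      aσ<a = <-by (0<* 0<a (<⇒0< σ<1)) (solve (a List.∷ σ List.∷ List.[]) ℚ-ring)
      baσ<b : b * (a * σ) < b
      baσ<b = <-by (0<* 0<b (<⇒0< (<-trans aσ<a a<1))) (solve (a List.∷ b List.∷ σ List.∷ List.[]) ℚ-ring)
    open Tail S 0<aσ (<⇒≤ aσ<a) public

  module Motion {σ σ′ : ℚ} (C : Crosses σ) (C′ : Crosses σ′) where
    private
      module C  = Crosses C
      module C′ = Crosses C′

    -- The line `σ` belongs to neither tail and is displaced here. Weight `σ′` times its constant
    -- `σ` seen from `(0,0)` equals weight `σ` times its constant `σ′` seen from `(1,1)`, once
    -- `σ + σ′ = 1 + b`.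
    indicator : ℚ → ℚ
    indicator v = restrict (v ≟ σ) (σ * σ′)

    F G : ℚ → ℚ
    F u = σ′ * C.f u + σ * C′.f (1ℚ + a - u)
    G v = σ′ * C.g v + σ * C′.g (1ℚ + b - v) + indicator v

    -- The tail towards `(1,1)` does not reach the bottom side. Away from `σ` the tie is that of the
    -- other tail; at `x = σ` the displacement `σ * σ′` of the crossing line matches the start
    -- `a * σ` of the tail, weighted by `σ′`.
    on-bottom : ∀ x → Unit x → F (0ℚ + a * x) ≡ a * G (x + b * 0ℚ)
    on-bottom x (0≤x , x≤1) = begin
      F (0ℚ + a * x)                              ≡⟨ cong F (+-identityˡ (a * x)) ⟩
      σ′ * C.f (a * x) + σ * C′.f (1ℚ + a - a * x)  ≡⟨ cong (λ w → σ′ * C.f (a * x) + σ * w) (C′.f-beyond f-far) ⟩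
      σ′ * C.f (a * x) + σ * 0ℚ                    ≡⟨ main ⟩
      a * (σ′ * C.g x + σ * 0ℚ + indicator x)       ≡⟨ cong (λ w → a * (σ′ * C.g x + σ * w + indicator x)) (C′.g-beyond g-far) ⟨
      a * G x                                     ≡⟨ cong (λ v → a * G v) (sym (p+q*0≡p b x)) ⟩
      a * G (x + b * 0ℚ)                           ∎
      where
      open ≡-Reasoning
      f-far : a * σ′ < 1ℚ + a - a * x
      f-far = <-≤-trans C′.aσ<a (≤-by (0≤+ (<⇒≤ 0<1-a) (0≤* (<⇒≤ 0<a) (≤⇒0≤ x≤1)))
        (solve (a List.∷ x List.∷ List.[]) ℚ-ring))
        where
        0<1-a : 0ℚ < 1ℚ - a
        0<1-a = <⇒0< a<1
      g-far : b * (a * σ′) < 1ℚ + b - x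
      g-far = <-≤-trans C′.baσ<b (≤-by (≤⇒0≤ x≤1) (solve (b List.∷ x List.∷ List.[]) ℚ-ring))
      main : σ′ * C.f (a * x) + σ * 0ℚ ≡ a * (σ′ * C.g x + σ * 0ℚ + indicator x)
      main with x ≟ σ
      ... | yes refl = begin
        σ′ * C.f (a * σ) + σ * 0ℚ             ≡⟨ cong (λ w → σ′ * w + σ * 0ℚ) C.f-start ⟩
        σ′ * (a * σ) + σ * 0ℚ                 ≡⟨ lemma a σ σ′ ⟩
        a * (σ′ * 0ℚ + σ * 0ℚ + σ * σ′)        ≡⟨ cong (λ w → a * (σ′ * w + σ * 0ℚ + σ * σ′)) (C.g-beyond (<-trans C.baσ<b C.b<σ)) ⟨
        a * (σ′ * C.g σ + σ * 0ℚ + σ * σ′)     ∎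
        where
        lemma : ∀ a σ σ′ → σ′ * (a * σ) + σ * 0ℚ ≡ a * (σ′ * 0ℚ + σ * 0ℚ + σ * σ′)
        lemma = solve-∀ ℚ-ring
      ... | no x≢σ = trans (cong (λ w → σ′ * w + σ * 0ℚ) (C.on-y≡0 x (x≢σ ∘ *-cancelˡ a (0<⇒≢0 0<a))))
        (lemma a σ σ′ (C.g x))
        where
        lemma : ∀ a σ σ′ w → σ′ * (a * w) + σ * 0ℚ ≡ a * (σ′ * w + σ * 0ℚ + 0ℚ)
        lemma = solve-∀ ℚ-ring

    on-left : ∀ y → Unit y → G (0ℚ + b * y) ≡ b * F (y + a * 0ℚ)
    on-left y (0≤y , y≤1) = begin
      G (0ℚ + b * y)                                                   ≡⟨ cong G (+-identityˡ (b * y)) ⟩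
      σ′ * C.g (b * y) + σ * C′.g (1ℚ + b - b * y) + indicator (b * y)  ≡⟨ cong₂ (λ w w′ → σ′ * C.g (b * y) + σ * w + w′) (C′.g-beyond g-far) (restrict-no (b * y ≟ σ) by≢σ) ⟩
      σ′ * C.g (b * y) + σ * 0ℚ + 0ℚ                                    ≡⟨ cong (λ w → σ′ * w + σ * 0ℚ + 0ℚ) (C.on-x≡0 y) ⟩
      σ′ * (b * C.f y) + σ * 0ℚ + 0ℚ                                    ≡⟨ lemma b σ σ′ (C.f y) ⟩
      b * (σ′ * C.f y + σ * 0ℚ)                                         ≡⟨ cong (λ w → b * (σ′ * C.f y + σ * w)) (C′.f-beyond f-far) ⟨
      b * F y                                                          ≡⟨ cong (λ v → b * F v) (sym (p+q*0≡p a y)) ⟩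
      b * F (y + a * 0ℚ)                                               ∎
      where
      open ≡-Reasoning
      lemma : ∀ b σ σ′ w → σ′ * (b * w) + σ * 0ℚ + 0ℚ ≡ b * (σ′ * w + σ * 0ℚ)
      lemma = solve-∀ ℚ-ring
      f-far : a * σ′ < 1ℚ + a - y
      f-far = <-≤-trans C′.aσ<a (≤-by (≤⇒0≤ y≤1) (solve (a List.∷ y List.∷ List.[]) ℚ-ring))
      by≤b : b * y ≤ b
      by≤b = ≤-by (0≤* (<⇒≤ 0<b) (≤⇒0≤ y≤1)) (solve (b List.∷ y List.∷ List.[]) ℚ-ring)
      by≢σ : b * y ≢ σ
      by≢σ e = <-irrefl e (≤-<-trans by≤b C.b<σ)
      g-far : b * (a * σ′) < 1ℚ + b - b * y
      g-far = <-≤-trans C′.baσ<b (≤-by (0≤+ (<⇒≤ (<⇒0< b<1)) (≤⇒0≤ by≤b)) (expand b y))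
        where
        expand : ∀ b y → (1ℚ - b) + (b - b * y) ≡ 1ℚ + b - b * y - b
        expand = solve-∀ ℚ-ring

  module _ {σ σ′ : ℚ} (C : Crosses σ) (C′ : Crosses σ′) (σ+σ′ : σ + σ′ ≡ 1ℚ + b) where
    private
      module M  = Motion C C′
      module M′ = Motion C′ C
      complement : ∀ a u → 1ℚ + a - (1ℚ + a - u) ≡ u
      complement = solve-∀ ℚ-ring

    -- Reflection in the centre exchanges the two tails and their weights; with `G-centre` this
    -- reduces the ties on the right and top sides to those on the left and bottom.
    F-centre : ∀ u → M.F u ≡ M′.F (1ℚ + a - u)
    F-centre u = trans (+-comm (σ′ * Crosses.f C u) _)
      (cong (λ w → σ * Crosses.f C′ (1ℚ + a - u) + σ′ * Crosses.f C w) (sym (complement a u)))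

    indicator-centre : ∀ v → M.indicator v ≡ M′.indicator (1ℚ + b - v)
    indicator-centre v with v ≟ σ
    ... | yes refl = trans (*-comm v σ′) (sym (restrict-yes (1ℚ + b - v ≟ σ′)
      (trans (cong (_- v) (sym σ+σ′)) (lemma v σ′))))
      where
      lemma : ∀ v σ′ → v + σ′ - v ≡ σ′
      lemma = solve-∀ ℚ-ring
    ... | no v≢σ = sym (restrict-no (1ℚ + b - v ≟ σ′) λ e → v≢σ
      (trans (sym (complement b v)) (trans (cong₂ _-_ (sym σ+σ′) e) (lemma σ σ′))))
      where
      lemma : ∀ v σ′ → v + σ′ - σ′ ≡ v
      lemma = solve-∀ ℚ-ring

    G-centre : ∀ v → M.G v ≡ M′.G (1ℚ + b - v)
    G-centre v = cong₂ _+_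
      (trans (+-comm (σ′ * Crosses.g C v) _)
        (cong (λ w → σ * Crosses.g C′ (1ℚ + b - v) + σ′ * Crosses.g C w) (sym (complement b v))))
      (indicator-centre v)

    module _ {q} {z : Fin q → Pt} (R : Rigid a b z) (box : ∀ i → Box (z i)) where

      hx-pt : ∀ p → Box p → Edge (proj₁ p) → M.G (line b (swap p)) ≡ b * M.F (line a p)
      hx-pt (x , y) (_ , uy) (inj₁ refl) = M.on-left y uy
      hx-pt (x , y) (_ , uy) (inj₂ refl) = begin
        M.G (1ℚ + b * y)                    ≡⟨ G-centre (1ℚ + b * y) ⟩
        M′.G (1ℚ + b - (1ℚ + b * y))         ≡⟨ cong M′.G (lemma₁ b y) ⟩
        M′.G (0ℚ + b * (1ℚ - y))             ≡⟨ M′.on-left (1ℚ - y) (Unit-1- uy) ⟩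
        b * M′.F ((1ℚ - y) + a * 0ℚ)         ≡⟨ cong (λ u → b * M′.F u) (lemma₂ a y) ⟩
        b * M′.F (1ℚ + a - (y + a * 1ℚ))     ≡⟨ cong (b *_) (F-centre (y + a * 1ℚ)) ⟨
        b * M.F (y + a * 1ℚ)                ∎
        where
        open ≡-Reasoning
        lemma₁ : ∀ b y → 1ℚ + b - (1ℚ + b * y) ≡ 0ℚ + b * (1ℚ - y)
        lemma₁ = solve-∀ ℚ-ring
        lemma₂ : ∀ a y → (1ℚ - y) + a * 0ℚ ≡ 1ℚ + a - (y + a * 1ℚ)
        lemma₂ = solve-∀ ℚ-ring

      hy-pt : ∀ p → Box p → Edge (proj₂ p) → M.F (line a p) ≡ a * M.G (line b (swap p))
      hy-pt (x , y) (ux , _) (inj₁ refl) = M.on-bottom x ux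
      hy-pt (x , y) (ux , _) (inj₂ refl) = begin
        M.F (1ℚ + a * x)                    ≡⟨ F-centre (1ℚ + a * x) ⟩
        M′.F (1ℚ + a - (1ℚ + a * x))         ≡⟨ cong M′.F (lemma₁ a x) ⟩
        M′.F (0ℚ + a * (1ℚ - x))             ≡⟨ M′.on-bottom (1ℚ - x) (Unit-1- ux) ⟩
        a * M′.G ((1ℚ - x) + b * 0ℚ)         ≡⟨ cong (λ u → a * M′.G u) (lemma₂ b x) ⟩
        a * M′.G (1ℚ + b - (x + b * 1ℚ))     ≡⟨ cong (a *_) (G-centre (x + b * 1ℚ)) ⟨
        a * M.G (x + b * 1ℚ)                ∎
        where
        open ≡-Reasoning
        lemma₁ : ∀ b y → 1ℚ + b - (1ℚ + b * y) ≡ 0ℚ + b * (1ℚ - y)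
        lemma₁ = solve-∀ ℚ-ring
        lemma₂ : ∀ a y → (1ℚ - y) + a * 0ℚ ≡ 1ℚ + a - (y + a * 1ℚ)
        lemma₂ = solve-∀ ℚ-ring

      -- Both tails vanish on the line `σ`, so the motion displaces it by exactly `σ * σ′`, which
      -- rigidity forbids if a piece lies on it.
      uncrossed : ∀ i → line b (swap (z i)) ≢ σ
      uncrossed i e = 0<0-absurd (0<* C.0<σ C′.0<σ) (begin
        σ * σ′                              ≡⟨ lemma σ σ′ ⟩
        σ′ * 0ℚ + σ * 0ℚ + σ * σ′            ≡⟨ cong₂ _+_ (cong₂ (λ w w′ → σ′ * w + σ * w′)
                                                 (C.g-beyond (<-trans C.baσ<b C.b<σ)) (C′.g-beyond g-far))
                                                 (restrict-yes (σ ≟ σ) refl) ⟨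
        M.G σ                               ≡⟨ cong M.G e ⟨
        M.G (line b (swap (z i)))           ≡⟨ proj₂ (R M.F M.G (λ j → hx-pt (z j) (box j))
                                                 (λ j → hy-pt (z j) (box j)) i) ⟩
        0ℚ                                  ∎)
        where
        open ≡-Reasoning
        module C  = Crosses C
        module C′ = Crosses C′
        lemma : ∀ σ σ′ → σ * σ′ ≡ σ′ * 0ℚ + σ * 0ℚ + σ * σ′
        lemma = solve-∀ ℚ-ring
        g-far : b * (a * σ′) < 1ℚ + b - σ
        g-far = <-trans C′.baσ<b (<-by (<⇒0< C.σ<1) (solve (b List.∷ σ List.∷ List.[]) ℚ-ring))

-- The condition `b < σ < 1` is invariant under the reflection to `1 + b - σ`, so the reflected line
-- crosses as well and supplies the second tail.
not-crossing : ∀ {a b q} {z : Fin q → Pt} → Slopes a b → Rigid a b z → (∀ i → Box (z i)) →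
  ∀ i → b < line b (swap (z i)) → line b (swap (z i)) < 1ℚ → ⊥
not-crossing {a} {b} {z = z} S R box i b<σ σ<1 =
  uncrossed {σ} {1ℚ + b - σ} (record { b<σ = b<σ ; σ<1 = σ<1 })
    (record { b<σ = <-by (<⇒0< σ<1) (lemma₁ b σ) ; σ<1 = <-by (<⇒0< b<σ) (lemma₂ b σ) })
    (lemma₃ b σ) R box i refl
  where
  open Crossing S
  σ = line b (swap (z i))
  lemma₁ : ∀ b σ → 1ℚ - σ ≡ 1ℚ + b - σ - b
  lemma₁ = solve-∀ ℚ-ring
  lemma₂ : ∀ b σ → σ - b ≡ 1ℚ - (1ℚ + b - σ)
  lemma₂ = solve-∀ ℚ-ring
  lemma₃ : ∀ b σ → σ + (1ℚ + b - σ) ≡ 1ℚ + b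
  lemma₃ = solve-∀ ℚ-ring

-- Trajectories of the corners

-- Constant of the line after `n` bounces from a corner: `1, a, a b, a² b, …`. The slopes alternate
-- because each bounce exchanges the two kinds of line.
ℓ : ℚ → ℚ → ℕ → ℚ
ℓ a b zero    = 1ℚ
ℓ a b (suc n) = a * ℓ b a n

opaque

  0<ℓ : ∀ {a b} → Slopes a b → ∀ n → 0ℚ < ℓ a b n
  0<ℓ S zero    = 0<1
  0<ℓ S (suc n) = 0<* (Slopes.0<a S) (0<ℓ (Slopes-swap S) n)

  ℓ-step : ∀ {a b} → Slopes a b → ∀ n → ℓ a b (suc n) < ℓ a b n
  ℓ-step {a} S zero = subst (_< 1ℚ) (sym (*-identityʳ a)) (Slopes.a<1 S)
  ℓ-step {a} S (suc n) = <-by (0<* (Slopes.0<a S) (<⇒0< (ℓ-step (Slopes-swap S) n))) (lemma a _ _)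
    where
    lemma : ∀ a p q → a * (p - q) ≡ a * p - a * q
    lemma = solve-∀ ℚ-ring

  ℓ-antitone : ∀ {a b m} → Slopes a b → ∀ n → m ℕ.< n → ℓ a b n < ℓ a b m
  ℓ-antitone S (suc n) m<1+n with ℕ.m<1+n⇒m<n∨m≡n m<1+n
  ... | inj₁ m<n  = <-trans (ℓ-step S n) (ℓ-antitone S n m<n)
  ... | inj₂ refl = ℓ-step S n

  ℓ-reflects-≤ : ∀ {a b} → Slopes a b → ∀ m n → ℓ a b m ≤ ℓ a b n → n ℕ.≤ m
  ℓ-reflects-≤ S m n h = ℕ.≮⇒≥ λ m<n → <-irrefl refl (≤-<-trans h (ℓ-antitone S n m<n))

-- The bounces between the line y + a x = ℓ a b n and the corner from which its
-- trajectory starts, the corner last.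
chain : ℚ → ℚ → ℕ → List Pt
chain a b zero    = []
chain a b (suc n) = (ℓ b a n , 0ℚ) ∷ map swap (chain b a n)

-- `chain a b n` together with the reflection of `chain b a n`, reordered in pairs of equal index so
-- that one induction shows all `2 n` points distinct.
twoChains : ℚ → ℚ → ℕ → List Pt
twoChains a b zero    = []
twoChains a b (suc n) = (ℓ b a n , 0ℚ) ∷ (0ℚ , ℓ a b n) ∷ twoChains a b n

-- Invariant behind distinctness: each bounce already listed lies farther out on its axis than the
-- bounces to be added next.
data Beyond (a b : ℚ) (n : ℕ) : Pt → Set where
  on-bottom : ∀ {x} → ℓ b a n < x → Beyond a b n (x , 0ℚ)
  on-left   : ∀ {y} → ℓ a b n < y → Beyond a b n (0ℚ , y)

Occupied : ∀ {q} → (Fin q → Pt) → Pt → Set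
Occupied z p = ∃ λ j → z j ≡ p

swap-injective : ∀ {p p′ : Pt} → swap p ≡ swap p′ → p ≡ p′
swap-injective = cong swap

opaque

  Beyond-suc : ∀ {a b n p} → Slopes a b → Beyond a b n p → Beyond a b (suc n) p
  Beyond-suc {n = n} S (on-bottom h) = on-bottom (<-trans (ℓ-step (Slopes-swap S) n) h)
  Beyond-suc {n = n} S (on-left h)   = on-left (<-trans (ℓ-step S n) h)

  Beyond-swap : ∀ {a b n p} → Beyond b a n p → Beyond a b n (swap p)
  Beyond-swap (on-bottom h) = on-left h
  Beyond-swap (on-left h)   = on-bottom h

  Beyond⇒≢ : ∀ {a b n p} → Slopes a b → Beyond a b n p → (ℓ b a n , 0ℚ) ≢ p
  Beyond⇒≢ S (on-bottom h) refl = <-irrefl refl h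
  Beyond⇒≢ {n = n} S (on-left h) e =
    <-asym (subst (ℓ _ _ n <_) (sym (cong proj₂ e)) h) (0<ℓ S n)

  chain-beyond : ∀ {a b} → Slopes a b → ∀ n → All (Beyond a b n) (chain a b n)
  chain-beyond S zero    = []
  chain-beyond S (suc n) = on-bottom (ℓ-step (Slopes-swap S) n) ∷
    All.map⁺ (All.map (Beyond-suc S ∘ Beyond-swap) (chain-beyond (Slopes-swap S) n))

  chain-unique : ∀ {a b} → Slopes a b → ∀ n → Unique (chain a b n)
  chain-unique S zero = []
  chain-unique S (suc n) =
    All.map⁺ (All.map (Beyond⇒≢ S ∘ Beyond-swap) (chain-beyond (Slopes-swap S) n))
    ∷ Unique.map⁺ swap-injective (chain-unique (Slopes-swap S) n)

  length-chain : ∀ a b n → length (chain a b n) ≡ n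
  length-chain a b zero    = refl
  length-chain a b (suc n) = cong suc (trans (length-map swap (chain b a n)) (length-chain b a n))

  twoChains-beyond : ∀ {a b} → Slopes a b → ∀ n → All (Beyond a b n) (twoChains a b n)
  twoChains-beyond S zero    = []
  twoChains-beyond S (suc n) = on-bottom (ℓ-step (Slopes-swap S) n) ∷ on-left (ℓ-step S n) ∷
    All.map (Beyond-suc S) (twoChains-beyond S n)

  twoChains-unique : ∀ {a b} → Slopes a b → ∀ n → Unique (twoChains a b n)
  twoChains-unique S zero = []
  twoChains-unique S (suc n) =
    ((λ e → 0<⇒≢0 (0<ℓ (Slopes-swap S) n) (cong proj₁ e)) ∷
      All.map (Beyond⇒≢ S) (twoChains-beyond S n))
    ∷ All.map (λ h e → Beyond⇒≢ (Slopes-swap S) (Beyond-swap h) (cong swap e)) (twoChains-beyond S n)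
    ∷ twoChains-unique S n

  length-twoChains : ∀ a b n → length (twoChains a b n) ≡ 2 ℕ.* n
  length-twoChains a b zero = refl
  length-twoChains a b (suc n) =
    trans (cong (suc ∘ suc) (length-twoChains a b n)) (sym (ℕ.*-suc 2 n))

  Occupied-swap : ∀ {q} {z : Fin q → Pt} {ps} →
    All (Occupied (swap ∘ z)) ps → All (Occupied z) (map swap ps)
  Occupied-swap = All.map⁺ ∘ All.map λ { (j , e) → j , cong swap e }

  Occupied-unswap : ∀ {q} {z : Fin q → Pt} {ps} →
    All (Occupied z) (map swap ps) → All (Occupied (swap ∘ z)) ps
  Occupied-unswap = All.map (λ { (j , e) → j , cong swap e }) ∘ All.map⁻

  -- Removing the first bounce of each chain leaves a chain of the other kind, so the two remainders
  -- exchange roles in the recursion.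
  twoChains-occupied : ∀ {a b q} {z : Fin q → Pt} n → All (Occupied z) (chain a b n) →
    All (Occupied (swap ∘ z)) (chain b a n) → All (Occupied z) (twoChains a b n)
  twoChains-occupied zero _ _ = []
  twoChains-occupied {z = z} (suc n) (o ∷ os) ((j , e) ∷ os′) = o ∷ (j , cong swap e) ∷
    twoChains-occupied n (Occupied-unswap os′)
      (Occupied-unswap os)

  lookup-injective : ∀ {A : Set} {xs : List A} → Unique xs → ∀ i j → lookup xs i ≡ lookup xs j → i ≡ j
  lookup-injective (_ ∷ _) Fin.zero    Fin.zero    _ = refl
  lookup-injective (x ∷ _) Fin.zero    (Fin.suc j) e = ⊥-elim (All.lookup x (∈-lookup j) e)
  lookup-injective (x ∷ _) (Fin.suc i) Fin.zero    e = ⊥-elim (All.lookup x (∈-lookup i) (sym e))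
  lookup-injective (_ ∷ u) (Fin.suc i) (Fin.suc j) e = cong Fin.suc (lookup-injective u i j e)

  -- Pigeonhole: choosing a piece at each of the distinct points is injective.
  occupied-length : ∀ {q} {z : Fin q → Pt} {ps} → All (Occupied z) ps → Unique ps → length ps ℕ.≤ q
  occupied-length {z = z} {ps} os u = injective⇒≤ {f = λ k → proj₁ (occ k)} λ {k} {k′} e →
    lookup-injective u k k′
      (trans (sym (proj₂ (occ k))) (trans (cong z e) (proj₂ (occ k′))))
    where
    occ : ∀ k → Occupied z (lookup ps k)
    occ k = All.lookup os (∈-lookup k)

OnTrajectory : ℚ → ℚ → ∀ {q} → (Fin q → Pt) → Fin q → Set
OnTrajectory a b z i = ∃ λ n → line a (z i) ≡ ℓ a b n × All (Occupied z) (chain a b n)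

opaque

  line-bottom : ∀ b {p} → proj₂ p ≡ 0ℚ → line b (swap p) ≡ proj₁ p
  line-bottom b {x , _} refl = p+q*0≡p b x

  trajectory-step : ∀ {a b q} {z : Fin q → Pt} i j → proj₂ (z j) ≡ 0ℚ → a * proj₁ (z j) ≡ line a (z i) →
    OnTrajectory b a (swap ∘ z) j → OnTrajectory a b z i
  trajectory-step {a} {b} {z = z} i j y≡0 ax≡t (n , s≡ , os) = suc n ,
    trans (sym ax≡t) (cong (a *_) x≡ℓ) , (j , cong₂ _,_ x≡ℓ y≡0) ∷ Occupied-swap {z = z} os
    where
    x≡ℓ : proj₁ (z j) ≡ ℓ b a n
    x≡ℓ = trans (sym (line-bottom b {z j} y≡0)) s≡

  -- Follows the trajectory outwards. A constant at most `a` has a piece at its preceding bounce by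
  -- `tail-occupied`, one strictly between `a` and `1` is excluded by `not-crossing`, and `1`
  -- belongs to a corner. Each step divides the constant by `a` or `b`, both at most `c`, so the
  -- lower bound `c ^' N` limits the number of steps.
  trajectory-fuel : ∀ N {a b c q} {z : Fin q → Pt} → Slopes a b → 0ℚ < c → a ≤ c → b ≤ c →
    Rigid a b z → (∀ i → Box (z i)) →
    ∀ i → c ^' N < line a (z i) → line a (z i) ≤ 1ℚ → OnTrajectory a b z i
  trajectory-fuel zero S 0<c a≤c b≤c R box i 1<t t≤1 = ⊥-elim (<-irrefl refl (<-≤-trans 1<t t≤1))
  trajectory-fuel (suc N) {a} {b} {c} {z = z} S 0<c a≤c b≤c R box i h t≤1
    with line a (z i) ≤? a | <-cmp (line a (z i)) 1ℚ
  ... | yes t≤a | _ =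
    let j , y≡0 , ax≡t = tail-occupied {a} {b} {z = z} S R box i (<-trans (0<^ (suc N) 0<c) h) t≤a
        line≡x = line-bottom b {z j} y≡0
    in trajectory-step {z = z} i j y≡0 ax≡t
      (trajectory-fuel N {b} {a} {z = swap ∘ z} (Slopes-swap S) 0<c b≤c a≤c (Rigid-swap {a} {b} {z = z} R) (swap ∘ box) j
        (subst (c ^' N <_) (sym line≡x)
          (c^N<x (proj₁ (proj₁ (box j))) (subst (c * c ^' N <_) (sym ax≡t) h)))
        (subst (_≤ 1ℚ) (sym line≡x) (proj₂ (proj₁ (box j)))))
    where
    c^N<x : ∀ {x} → 0ℚ ≤ x → c * c ^' N < a * x → c ^' N < x
    c^N<x {x} 0≤x cc<ax = ≰⇒> λ x≤c^N → <-irrefl refl (<-≤-trans cc<ax (≤-by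
      (0≤+ (0≤* (<⇒≤ 0<c) (≤⇒0≤ x≤c^N)) (0≤* (≤⇒0≤ a≤c) 0≤x)) (lemma a c x (c ^' N))))
      where
      lemma : ∀ a c x p → c * (p - x) + (c - a) * x ≡ c * p - a * x
      lemma = solve-∀ ℚ-ring
  ... | no t≰a | tri< t<1 _ _ =
    ⊥-elim (not-crossing {b} {a} {z = swap ∘ z} (Slopes-swap S) (Rigid-swap {a} {b} {z = z} R) (swap ∘ box) i (≰⇒> t≰a) t<1)
  ... | no _ | tri≈ _ t≡1 _ = 0 , t≡1 , []
  ... | no _ | tri> _ _ 1<t = ⊥-elim (<-irrefl refl (<-≤-trans 1<t t≤1))

  on-trajectory : ∀ {a b q} {z : Fin q → Pt} → Slopes a b → Rigid a b z → (∀ i → Box (z i)) →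
    ∀ i → 0ℚ < line a (z i) → line a (z i) ≤ 1ℚ → OnTrajectory a b z i
  on-trajectory {a} {b} {z = z} S R box i 0<t t≤1 with ≤-total a b
  ... | inj₁ a≤b = let N , h = powers-vanish (Slopes.0<b S) (Slopes.b<1 S) 0<t in
    trajectory-fuel N {a} {b} {z = z} S (Slopes.0<b S) a≤b ≤-refl R box i h t≤1
  ... | inj₂ b≤a = let N , h = powers-vanish (Slopes.0<a S) (Slopes.a<1 S) 0<t in
    trajectory-fuel N {a} {b} {z = z} S (Slopes.0<a S) ≤-refl b≤a R box i h t≤1

-- Upper bound for the denominators of a vertex

DenominatorsDivide : ℕ → Pt → Set
DenominatorsDivide D (x , y) = (↧ₙ x ∣ D) × (↧ₙ y ∣ D)

-- Links the geometry to the sequences: `seqLcm` will be the least such `D` for divisibility. A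
-- meeting of index `n` takes `2 n` bounces and the piece itself, hence the bound on `q`; the
-- meeting of index `0` is the central image of that of index `1`.
record Bound (a b : ℚ) (q D : ℕ) : Set where
  field
    boundary : ∀ n → n ℕ.< q → DenominatorsDivide D (ℓ a b n , ℓ b a n)
    interior : ∀ n → 1 ℕ.≤ n → suc (2 ℕ.* n) ℕ.≤ q → ∀ p →
      line a p ≡ ℓ a b n → line b (swap p) ≡ ℓ b a n → DenominatorsDivide D p

Bound-swap : ∀ {a b q D} → Bound a b q D → Bound b a q D
Bound-swap B = record
  { boundary = λ n n<q → swap (Bound.boundary B n n<q)
  ; interior = λ n 1≤n 2n<q p t s → swap (Bound.interior B n 1≤n 2n<q (swap p) s t)
  }

opaque

  -- Here `(1 - a b) x = s - b t` vanishes, where `t` and `s` are the two constants, so the lines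
  -- meet at their common bounce `(0 , ℓ a b n)`.
  consecutive-lines : ∀ {a b q D} → Slopes a b → Bound a b q D → ∀ n → n ℕ.< q → ∀ p →
    line a p ≡ ℓ a b n → line b (swap p) ≡ ℓ b a (suc n) → DenominatorsDivide D p
  consecutive-lines {a} {b} {D = D} S B n n<q (x , y) t≡ s≡ =
    subst (λ w → ↧ₙ w ∣ D) (sym x≡0) (1∣ D) ,
    subst (λ w → ↧ₙ w ∣ D) (sym y≡ℓ) (proj₁ (Bound.boundary B n n<q))
    where
    open Slopes S
    lemma : ∀ a b x y → (1ℚ - a * b) * x ≡ x + b * y - b * (y + a * x)
    lemma = solve-∀ ℚ-ring
    x≡0 : x ≡ 0ℚ
    x≡0 = *-cancelˡ (1ℚ - a * b) (0<⇒≢0 0<1-r) (trans (lemma a b x y)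
      (trans (cong₂ _-_ s≡ (cong (b *_) t≡)) (trans (+-inverseʳ (b * ℓ a b n)) (sym (*-zeroʳ (1ℚ - a * b))))))
    y≡ℓ : y ≡ ℓ a b n
    y≡ℓ = trans (sym (p+q*0≡p a y)) (trans (cong (λ w → y + a * w) (sym x≡0)) t≡)

  -- The gap is `(1 - a * b) * x`. On trajectories this makes the indices of the two lines through a
  -- point of the box differ by at most one.
  line-bound : ∀ {a b} → Slopes a b → ∀ {p} → Box p → b * line a p ≤ line b (swap p)
  line-bound {a} {b} S {x , y} ((0≤x , _) , _) = ≤-by (0≤* (<⇒≤ (Slopes.0<1-r S)) 0≤x) (lemma a b x y)
    where
    lemma : ∀ a b x y → (1ℚ - a * b) * x ≡ x + b * y - b * (y + a * x)
    lemma = solve-∀ ℚ-ring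

  -- `line-bound` both ways leaves `k = n`, `n + 1` or `n - 1`. Neighbouring indices give a bounce;
  -- equal ones give a meeting, where the two chains and piece `i` itself are `2 n + 1` different
  -- points.
  occupied-intersection : ∀ {a b q D} {z : Fin q → Pt} → Slopes a b → Bound a b q D →
    ∀ i → Box (z i) → ∀ n k →
    line a (z i) ≡ ℓ a b n → All (Occupied z) (chain a b n) →
    line b (swap (z i)) ≡ ℓ b a k → All (Occupied (swap ∘ z)) (chain b a k) →
    (n ≡ 0 → k ≡ 0 → ⊥) → DenominatorsDivide D (z i)
  occupied-intersection {a} {b} {q} {D} {z} S B i box n k t≡ os s≡ os′ not-both = cases (ℕ.<-cmp n k)
    where
    k≤1+n : k ℕ.≤ suc n
    k≤1+n = ℓ-reflects-≤ (Slopes-swap S) (suc n) k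
      (subst₂ _≤_ (cong (b *_) t≡) s≡ (line-bound S {z i} box))
    n≤1+k : n ℕ.≤ suc k
    n≤1+k = ℓ-reflects-≤ S (suc k) n
      (subst₂ _≤_ (cong (a *_) s≡) t≡ (line-bound (Slopes-swap S) {swap (z i)} (swap box)))
    chain-length : ∀ {a b} {z : Fin q → Pt} → Slopes a b → ∀ m → All (Occupied z) (chain a b m) → m ℕ.≤ q
    chain-length {a} {b} S m os =
      subst (ℕ._≤ q) (length-chain a b m) (occupied-length os (chain-unique S m))
    off-chains : ∀ {p} → Beyond a b n p → line a p ≡ ℓ a b n → line b (swap p) ≡ ℓ b a n → ⊥
    off-chains (on-bottom {x} h) _ s = <-irrefl refl (subst (ℓ b a n <_) (trans (sym (p+q*0≡p b x)) s) h)
    off-chains (on-left {y} h)   t _ = <-irrefl refl (subst (ℓ a b n <_) (trans (sym (p+q*0≡p a y)) t) h)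
    cases : Tri (n ℕ.< k) (n ≡ k) (k ℕ.< n) → DenominatorsDivide D (z i)
    cases (tri< n<k _ _) = consecutive-lines S B n
      (ℕ.≤-trans n<k (chain-length (Slopes-swap S) k os′)) (z i) t≡
      (trans s≡ (cong (ℓ b a) (ℕ.≤-antisym k≤1+n n<k)))
    cases (tri> _ _ k<n) = swap (consecutive-lines (Slopes-swap S) (Bound-swap B) k
      (ℕ.≤-trans k<n (chain-length S n os)) (swap (z i)) s≡
      (trans t≡ (cong (ℓ a b) (ℕ.≤-antisym n≤1+k k<n))))
    cases (tri≈ _ n≡k _) = Bound.interior B n (ℕ.n≢0⇒n>0 λ e → not-both e (trans (sym n≡k) e))
      2n<q (z i) t≡ s≡ℓn
      where
      s≡ℓn : line b (swap (z i)) ≡ ℓ b a n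
      s≡ℓn = trans s≡ (cong (ℓ b a) (sym n≡k))
      2n<q : suc (2 ℕ.* n) ℕ.≤ q
      2n<q = subst (λ m → suc m ℕ.≤ q) (length-twoChains a b n)
        (occupied-length {z = z}
          ((i , refl) ∷ twoChains-occupied n os
            (subst (λ m → All (Occupied (swap ∘ z)) (chain b a m)) (sym n≡k) os′))
          (All.map (λ h e → off-chains h (trans (cong (line a) (sym e)) t≡)
            (trans (cong (line b ∘ swap) (sym e)) s≡ℓn)) (twoChains-beyond S n) ∷ twoChains-unique S n))

  piece-below : ∀ {a b q D} {z : Fin q → Pt} → Slopes a b → Bound a b q D → Rigid a b z →
    (∀ i → Box (z i)) → ∀ i → line a (z i) ≤ 1ℚ → line b (swap (z i)) ≤ 1ℚ →
    (line a (z i) ≡ 1ℚ → line b (swap (z i)) ≡ 1ℚ → ⊥) →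
    0ℚ < line a (z i) → 0ℚ < line b (swap (z i)) → DenominatorsDivide D (z i)
  piece-below {a} {b} {z = z} S B R box i t≤1 s≤1 not-both 0<t 0<s =
    let n , t≡ , os  = on-trajectory {a} {b} {z = z} S R box i 0<t t≤1
        k , s≡ , os′ = on-trajectory {b} {a} {z = swap ∘ z} (Slopes-swap S) (Rigid-swap {a} {b} {z = z} R)
                         (swap ∘ box) i 0<s s≤1
    in occupied-intersection {z = z} S B i (box i) n k t≡ os s≡ os′
         λ n≡0 k≡0 → not-both (trans t≡ (cong (ℓ a b) n≡0)) (trans s≡ (cong (ℓ b a) k≡0))

opaque

  denominator-neg : ∀ x {n} → ↧ₙ x ∣ n → ↧ₙ (- x) ∣ n
  denominator-neg x {n} h = subst (_∣ n) (sym (Int.+-injective (↧-neg x))) h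

  -- Before reduction `1 - x` has the denominator of `x`; the reduced denominator divides it, the
  -- quotient being the cancelled factor `g`.
  denominator-1-∣ : ∀ x → ↧ₙ (1ℚ - x) ∣ ↧ₙ x
  denominator-1-∣ x = divides Int.∣ g ∣ (begin
    ↧ₙ x                        ≡⟨ Int.+-injective (↧-neg x) ⟨
    ↧ₙ (- x)                    ≡⟨ ℕ.+-identityʳ _ ⟨
    1 ℕ.* ↧ₙ (- x)              ≡⟨ cong Int.∣_∣ (proj₂ (sum (- x))) ⟨
    Int.∣ ↧ (1ℚ - x) Int.* g ∣      ≡⟨ Int.abs-* (↧ (1ℚ - x)) g ⟩
    ↧ₙ (1ℚ - x) ℕ.* Int.∣ g ∣     ≡⟨ ℕ.*-comm (↧ₙ (1ℚ - x)) Int.∣ g ∣ ⟩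
    Int.∣ g ∣ ℕ.* ↧ₙ (1ℚ - x)     ∎)
    where
    open ≡-Reasoning
    sum : ∀ y → ∃ λ g → ↧ (1ℚ + y) Int.* g ≡ Int.+ (1 ℕ.* ↧ₙ y)
    sum y@record{} = _ , ↧-/ (↥ 1ℚ Int.* ↧ y Int.+ ↥ y Int.* ↧ 1ℚ) (↧ₙ 1ℚ ℕ.* ↧ₙ y)
    g : ℤ
    g = proj₁ (sum (- x))

  denominator-1- : ∀ x {n} → ↧ₙ x ∣ n → ↧ₙ (1ℚ - x) ∣ n
  denominator-1- x = ∣-trans (denominator-1-∣ x)

  denominator-1-⁻ : ∀ x {n} → ↧ₙ (1ℚ - x) ∣ n → ↧ₙ x ∣ n
  denominator-1-⁻ x {n} h = subst (λ y → ↧ₙ y ∣ n) (1-[1-p]≡p x) (denominator-1- (1ℚ - x) h)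

  line-nonneg : ∀ {a b p} → Slopes a b → Box p → 0ℚ ≤ line a p
  line-nonneg S ((0≤x , _) , (0≤y , _)) = 0≤+ 0≤y (0≤* (<⇒≤ (Slopes.0<a S)) 0≤x)

  line≡0 : ∀ {a b p D} → Slopes a b → Box p → 0ℚ ≡ line a p → DenominatorsDivide D p
  line≡0 {a} {b} {x , y} {D} S ((0≤x , _) , (0≤y , _)) e =
    subst (λ w → ↧ₙ w ∣ D) (≤-antisym 0≤x x≤0) (1∣ D) , subst (λ w → ↧ₙ w ∣ D) (≤-antisym 0≤y y≤0) (1∣ D)
    where
    open Slopes S
    y≤0 : y ≤ 0ℚ
    y≤0 = ≤-by (0≤* (<⇒≤ 0<a) 0≤x) (trans (lemma a x y) (cong (_- y) (sym e)))
      where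
      lemma : ∀ a x y → a * x ≡ (y + a * x) - y
      lemma = solve-∀ ℚ-ring
    x≤0 : x ≤ 0ℚ
    x≤0 = *-cancelˡ-≤ a 0<a (≤-by 0≤y (trans (lemma a x y)
      (trans (cong (_- a * x) (sym e)) (cong (_- a * x) (sym (*-zeroʳ a))))))
      where
      lemma : ∀ a x y → y ≡ (y + a * x) - a * x
      lemma = solve-∀ ℚ-ring

  piece-below′ : ∀ {a b q D} {z : Fin q → Pt} → Slopes a b → Bound a b q D → Rigid a b z →
    (∀ i → Box (z i)) → ∀ i → line a (z i) ≤ 1ℚ → line b (swap (z i)) ≤ 1ℚ →
    (line a (z i) ≡ 1ℚ → line b (swap (z i)) ≡ 1ℚ → ⊥) → DenominatorsDivide D (z i)
  piece-below′ {a} {b} {z = z} S B R box i t≤1 s≤1 not-both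
    with 0ℚ ≟ line a (z i) | 0ℚ ≟ line b (swap (z i))
  ... | yes 0≡t | _ = line≡0 {p = z i} S (box i) 0≡t
  ... | no _ | yes 0≡s = swap (line≡0 {p = swap (z i)} (Slopes-swap S) (swap (box i)) 0≡s)
  ... | no 0≢t | no 0≢s = piece-below {z = z} S B R box i t≤1 s≤1 not-both
    (≤∧≢⇒< (line-nonneg {p = z i} S (box i)) 0≢t)
    (≤∧≢⇒< (line-nonneg {p = swap (z i)} (Slopes-swap S) (swap (box i))) 0≢s)
    where
    ≤∧≢⇒< : ∀ {p q} → p ≤ q → p ≢ q → p < q
    ≤∧≢⇒< p≤q p≢q = ≰⇒> λ q≤p → p≢q (≤-antisym p≤q q≤p)

  -- Reflection turns `t > 1` into `1 + a - t < a`; by `line-bound` the other reflected constant is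
  -- at most this divided by `a`, hence below `1`.
  high-line : ∀ {a b p} → Slopes a b → Box p → 1ℚ < line a p →
    line a (centre p) < 1ℚ × line b (swap (centre p)) < 1ℚ
  high-line {a} {b} {p} S box 1<t = <-trans t′<a a<1 ,
    ≰⇒> λ 1≤s → <-irrefl refl (<-≤-trans t′<a (≤-trans (subst (_≤ a * line b (swap (centre p))) (*-identityʳ a)
      (*-monoˡ-≤-nonNeg a {{nonNegative (<⇒≤ 0<a)}} 1≤s))
      (line-bound (Slopes-swap S) {swap (centre p)} (Unit-1- (proj₂ box) , Unit-1- (proj₁ box)))))
    where
    open Slopes S
    t′<a : line a (centre p) < a
    t′<a = subst (_< a) (sym (line-centre a p)) (<-by (<⇒0< 1<t) (lemma a (line a p)))
      where
      lemma : ∀ a t → t - 1ℚ ≡ a - (1ℚ + a - t)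
      lemma = solve-∀ ℚ-ring

  via-centre : ∀ {a b q D} {z : Fin q → Pt} → Slopes a b → Bound a b q D → Rigid a b z →
    (∀ i → Box (z i)) → ∀ i → line a (centre (z i)) < 1ℚ → line b (swap (centre (z i))) < 1ℚ →
    DenominatorsDivide D (z i)
  via-centre {a} {b} {z = z} S B R box i t<1 s<1 =
    let dx , dy = piece-below′ {z = centre ∘ z} S B (Rigid-centre {a} {b} {z = z} R)
          (λ j → Unit-1- (proj₁ (box j)) , Unit-1- (proj₂ (box j))) i (<⇒≤ t<1) (<⇒≤ s<1)
          (λ e _ → <-irrefl e t<1)
    in denominator-1-⁻ (proj₁ (z i)) dx , denominator-1-⁻ (proj₂ (z i)) dy

  piece-divides : ∀ {a b q D} {z : Fin q → Pt} → Slopes a b → Bound a b q D → Rigid a b z →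
    (∀ i → Box (z i)) → ∀ i → DenominatorsDivide D (z i)
  piece-divides {a} {b} {q} {D} {z} S B R box i
    with line a (z i) ≤? 1ℚ | line b (swap (z i)) ≤? 1ℚ
       | line a (z i) ≟ 1ℚ | line b (swap (z i)) ≟ 1ℚ
  ... | yes t≤1 | yes s≤1 | no t≢1 | _ = piece-below′ {z = z} S B R box i t≤1 s≤1 (λ e _ → t≢1 e)
  ... | yes t≤1 | yes s≤1 | yes _ | no s≢1 = piece-below′ {z = z} S B R box i t≤1 s≤1 (λ _ e → s≢1 e)
  -- The meeting of index `0`: the central symmetry turns the two constants into `a` and `b`, both
  -- below `1`.
  ... | yes t≤1 | yes s≤1 | yes t≡1 | yes s≡1 = via-centre {z = z} S B R box i
      (subst (_< 1ℚ) (sym (trans (line-centre a (z i)) (trans (cong (λ t → 1ℚ + a - t) t≡1) (lemma a)))) (Slopes.a<1 S))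
      (subst (_< 1ℚ) (sym (trans (line-centre b (swap (z i))) (trans (cong (λ s → 1ℚ + b - s) s≡1) (lemma b)))) (Slopes.b<1 S))
    where
    lemma : ∀ a → 1ℚ + a - 1ℚ ≡ a
    lemma = solve-∀ ℚ-ring
  ... | no t≰1 | _ | _ | _ = let h , k = high-line {p = z i} S (box i) (≰⇒> t≰1) in via-centre {z = z} S B R box i h k
  ... | yes _ | no s≰1 | _ | _ =
    let h , k = high-line {p = swap (z i)} (Slopes-swap S) (swap (box i)) (≰⇒> s≰1) in via-centre {z = z} S B R box i k h

-- Vertices as rigid configurations

-- Passing to `1 - x` brings the attack lines, which have positive slope, into the form
-- `y + a x = u` or `x + b y = v` with positive coefficients.
mirror : Pt → Pt
mirror (x , y) = (1ℚ - x , y)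

mirror² : ∀ p → mirror (mirror p) ≡ p
mirror² (x , y) = cong (_, y) (1-[1-p]≡p x)

opaque

  intersection-unique : ∀ {a b} → Slopes a b → ∀ {p p′} →
    line a p ≡ line a p′ → line b (swap p) ≡ line b (swap p′) → p ≡ p′
  intersection-unique {a} {b} S {x , y} {x′ , y′} e e′ = cong₂ _,_
    (*-cancelˡ (1ℚ - a * b) (0<⇒≢0 0<1-r)
      (trans (lemma₁ a b x y) (trans (cong₂ (λ u v → v - b * u) e e′) (sym (lemma₁ a b x′ y′)))))
    (*-cancelˡ (1ℚ - a * b) (0<⇒≢0 0<1-r)
      (trans (lemma₂ a b x y) (trans (cong₂ (λ u v → u - a * v) e e′) (sym (lemma₂ a b x′ y′)))))
    where
    open Slopes S
    lemma₁ : ∀ a b x y → (1ℚ - a * b) * x ≡ x + b * y - b * (y + a * x)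
    lemma₁ = solve-∀ ℚ-ring
    lemma₂ : ∀ a b x y → (1ℚ - a * b) * y ≡ y + a * x - a * (x + b * y)
    lemma₂ = solve-∀ ℚ-ring

-- The ways in which two hyperplanes fix a piece once the earlier pieces are known. This triangular
-- scheme makes every initial segment of a sequence in the box a vertex.
data Support (a b : ℚ) (p : ℕ → Pt) (m : ℕ) : Set where
  corner  : Edge (proj₁ (p m)) → Edge (proj₂ (p m)) → Support a b p m
  on-side : ∀ {k} → k ℕ.< m → Edge (proj₁ (p m)) → line a (p m) ≡ line a (p k) → Support a b p m
  on-base : ∀ {k} → k ℕ.< m → Edge (proj₂ (p m)) →
            line b (swap (p m)) ≡ line b (swap (p k)) → Support a b p m
  meeting : ∀ {k k′} → k ℕ.< m → k′ ℕ.< m → line a (p m) ≡ line a (p k) →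
            line b (swap (p m)) ≡ line b (swap (p k′)) → Support a b p m

module Vertices (P : Moves) {a b : ℚ} (S : Slopes a b)
  (c₁≢0 : ⟦ Moves.c₁ P ⟧ ≢ 0ℚ) (d₂≢0 : ⟦ Moves.d₂ P ⟧ ≢ 0ℚ)
  (d₁≡ : ⟦ Moves.d₁ P ⟧ ≡ a * ⟦ Moves.c₁ P ⟧) (c₂≡ : ⟦ Moves.c₂ P ⟧ ≡ b * ⟦ Moves.d₂ P ⟧)
  where
  open Moves P
  open Slopes S

  t s : Pt → ℚ
  t p = line a (mirror p)
  s p = line b (swap (mirror p))

  opaque

    attack₁ : ∀ p p′ c d → d ≡ a * c →
      (proj₁ p - proj₁ p′) * d - (proj₂ p - proj₂ p′) * c ≡ c * (t p′ - t p)
    attack₁ (x , y) (x′ , y′) c .(a * c) refl = lemma a x y x′ y′ c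
      where
      lemma : ∀ a x y x′ y′ c → (x - x′) * (a * c) - (y - y′) * c ≡
        c * (y′ + a * (1ℚ - x′) - (y + a * (1ℚ - x)))
      lemma = solve-∀ ℚ-ring

    attack₂ : ∀ p p′ c d → c ≡ b * d →
      (proj₁ p - proj₁ p′) * d - (proj₂ p - proj₂ p′) * c ≡ d * (s p′ - s p)
    attack₂ (x , y) (x′ , y′) .(b * d) d refl = lemma b x y x′ y′ d
      where
      lemma : ∀ b x y x′ y′ d → (x - x′) * d - (y - y′) * (b * d) ≡
        d * ((1ℚ - x′) + b * y′ - ((1ℚ - x) + b * y))
      lemma = solve-∀ ℚ-ring

    difference≡0 : ∀ {c p q} → c ≢ 0ℚ → c * (q - p) ≡ 0ℚ → p ≡ q
    difference≡0 {c} {p} {q} c≢0 e =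
      trans (sym (+-identityˡ p)) (trans (cong (_+ p) (sym q-p≡0)) (p-q+q≡p q p))
      where
      q-p≡0 : q - p ≡ 0ℚ
      q-p≡0 = *-cancelˡ c c≢0 (trans e (sym (*-zeroʳ c)))

    equal⇒0 : ∀ {c p q} → p ≡ q → c * (q - p) ≡ 0ℚ
    equal⇒0 {c} {p} refl = trans (cong (c *_) (+-inverseʳ p)) (*-zeroʳ c)

    attack₁⇒ : ∀ {q} (z : Config P q) i j {i≢j} → OnHyp P z (attack i j i≢j Fin.zero) → t (z i) ≡ t (z j)
    attack₁⇒ z i j e = difference≡0 c₁≢0 (trans (sym (attack₁ (z i) (z j) ⟦ c₁ ⟧ ⟦ d₁ ⟧ d₁≡)) e)

    attack₁⇐ : ∀ {q} (z : Config P q) i j {i≢j} → t (z i) ≡ t (z j) → OnHyp P z (attack i j i≢j Fin.zero)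
    attack₁⇐ z i j e = trans (attack₁ (z i) (z j) ⟦ c₁ ⟧ ⟦ d₁ ⟧ d₁≡) (equal⇒0 {⟦ c₁ ⟧} e)

    attack₂⇒ : ∀ {q} (z : Config P q) i j {i≢j r} → OnHyp P z (attack i j i≢j (Fin.suc r)) → s (z i) ≡ s (z j)
    attack₂⇒ z i j e = difference≡0 d₂≢0 (trans (sym (attack₂ (z i) (z j) ⟦ c₂ ⟧ ⟦ d₂ ⟧ c₂≡)) e)

    attack₂⇐ : ∀ {q} (z : Config P q) i j {i≢j r} → s (z i) ≡ s (z j) → OnHyp P z (attack i j i≢j (Fin.suc r))
    attack₂⇐ z i j e = trans (attack₂ (z i) (z j) ⟦ c₂ ⟧ ⟦ d₂ ⟧ c₂≡) (equal⇒0 {⟦ d₂ ⟧} e)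

    -- Moving the pieces according to `f` and `g` keeps every hyperplane of the collection: attacks
    -- because pieces on one line have equal displacements of it, fixations by the ties. Uniqueness
    -- of the vertex then leaves each piece in place.
    vertex⇒rigid : ∀ {q} (z : Config P q) → IsVertex P z → Rigid a b (mirror ∘ z)
    vertex⇒rigid {q} z (_ , H , on , unique) f g hx hy i =
      vanish (trans (sym (t-moved (z i))) (cong t (w≡z i))) ,
      vanish (trans (sym (s-moved (z i))) (cong s (w≡z i)))
      where
      δx δy : Pt → ℚ
      -- Solves for the displacement up to the determinant, so that the two lines of a piece move by
      -- `(1 - a b) f` and `(1 - a b) g`.
      δx p = g (s p) - b * f (t p)
      δy p = f (t p) - a * g (s p)
      moved : Pt → Pt
      moved p = (proj₁ p - δx p , proj₂ p + δy p)
      t-moved : ∀ p → t (moved p) ≡ t p + (1ℚ - a * b) * f (t p)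
      t-moved p = lemma a b (proj₁ p) (proj₂ p) (f (t p)) (g (s p))
        where
        lemma : ∀ a b x y f g → (y + (f - a * g)) + a * (1ℚ - (x - (g - b * f))) ≡
          y + a * (1ℚ - x) + (1ℚ - a * b) * f
        lemma = solve-∀ ℚ-ring
      s-moved : ∀ p → s (moved p) ≡ s p + (1ℚ - a * b) * g (s p)
      s-moved p = lemma a b (proj₁ p) (proj₂ p) (f (t p)) (g (s p))
        where
        lemma : ∀ a b x y f g → (1ℚ - (x - (g - b * f))) + b * (y + (f - a * g)) ≡
          (1ℚ - x) + b * y + (1ℚ - a * b) * g
        lemma = solve-∀ ℚ-ring
      vanish : ∀ {u v} → u + (1ℚ - a * b) * v ≡ u → v ≡ 0ℚ
      vanish {u} {v} e = *-cancelˡ (1ℚ - a * b) (0<⇒≢0 0<1-r)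
        (trans (lemma u _) (trans (cong (_- u) e) (trans (+-inverseʳ u) (sym (*-zeroʳ (1ℚ - a * b))))))
        where
        lemma : ∀ u v → v ≡ u + v - u
        lemma = solve-∀ ℚ-ring
      x-fixed : ∀ {u v w k} → u ≡ v → w ≡ k → w - (u - v) ≡ k
      x-fixed {u} {w = w} refl refl = lemma u w
        where
        lemma : ∀ u w → w - (u - u) ≡ w
        lemma = solve-∀ ℚ-ring
      y-fixed : ∀ {u v w k} → u ≡ v → w ≡ k → w + (u - v) ≡ k
      y-fixed {u} {w = w} refl refl = lemma u w
        where
        lemma : ∀ u w → w + (u - u) ≡ w
        lemma = solve-∀ ℚ-ring
      edge-x : ∀ {x} v → x ≡ b2q P v → Edge (1ℚ - x)
      edge-x false refl = inj₂ refl
      edge-x true  refl = inj₁ refl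
      edge-y : ∀ {y} v → y ≡ b2q P v → Edge y
      edge-y false refl = inj₁ refl
      edge-y true  refl = inj₂ refl
      keeps : ∀ h → OnHyp P z h → OnHyp P (moved ∘ z) h
      keeps (attack j k j≢k Fin.zero) e = attack₁⇐ (moved ∘ z) j k {j≢k}
        (trans (t-moved (z j)) (trans (cong (λ u → u + (1ℚ - a * b) * f u) (attack₁⇒ z j k {j≢k} e))
          (sym (t-moved (z k)))))
      keeps (attack j k j≢k (Fin.suc r)) e = attack₂⇐ (moved ∘ z) j k {j≢k} {r}
        (trans (s-moved (z j)) (trans (cong (λ u → u + (1ℚ - a * b) * g u) (attack₂⇒ z j k {j≢k} {r} e))
          (sym (s-moved (z k)))))
      keeps (fixX j v) e = x-fixed (hx j (edge-x v e)) e
      keeps (fixY j v) e = y-fixed (hy j (edge-y v e)) e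
      w≡z : ∀ i → moved (z i) ≡ z i
      w≡z = unique (moved ∘ z) (All.map (λ {h} → keeps h) on)

    lines-determine : ∀ {p p′} → t p ≡ t p′ → s p ≡ s p′ → p ≡ p′
    lines-determine {p} {p′} e e′ = trans (sym (mirror² p))
      (trans (cong mirror (intersection-unique S {mirror p} {mirror p′} e e′)) (mirror² p′))

    side-determines : ∀ {p p′} → t p ≡ t p′ → proj₁ p ≡ proj₁ p′ → p ≡ p′
    side-determines {x , y} {x′ , y′} e refl = cong (x ,_)
      (trans (lemma a x y) (trans (cong (_- a * (1ℚ - x)) e) (sym (lemma a x y′))))
      where
      lemma : ∀ a x y → y ≡ y + a * (1ℚ - x) - a * (1ℚ - x)
      lemma = solve-∀ ℚ-ring

    base-determines : ∀ {p p′} → s p ≡ s p′ → proj₂ p ≡ proj₂ p′ → p ≡ p′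
    base-determines {x , y} {x′ , y′} e refl = cong (_, y)
      (trans (lemma b x y) (trans (cong (λ v → 1ℚ - (v - b * y)) e) (sym (lemma b x′ y))))
      where
      lemma : ∀ b x y → x ≡ 1ℚ - ((1ℚ - x) + b * y - b * y)
      lemma = solve-∀ ℚ-ring

  module _ (p : ℕ → Pt) (support : ∀ m → Support a b p m) (box : ∀ m → Box (p m)) (q : ℕ) where

    config : Config P q
    config i = mirror (p (toℕ i))

    private
      sideX sideY : ∀ {x} → Edge x → Bool
      -- `config` mirrors the first coordinate, which exchanges the sides `x = 0` and `x = 1`.
      sideX (inj₁ _) = true
      sideX (inj₂ _) = false
      sideY (inj₁ _) = false
      sideY (inj₂ _) = true

      earlier : ∀ {i : Fin q} {k} → k ℕ.< toℕ i → Fin q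
      earlier {i} k<i = fromℕ< (ℕ.<-trans k<i (toℕ<n i))

      toℕ-earlier : ∀ {i : Fin q} {k} (k<i : k ℕ.< toℕ i) → toℕ (earlier {i} k<i) ≡ k
      toℕ-earlier {i} k<i = toℕ-fromℕ< (ℕ.<-trans k<i (toℕ<n i))

      earlier-≢ : ∀ {i : Fin q} {k} (k<i : k ℕ.< toℕ i) → i ≢ earlier {i} k<i
      earlier-≢ {i} k<i e = ℕ.<⇒≢ k<i (trans (sym (toℕ-earlier {i} k<i)) (cong toℕ (sym e)))

      hyperplanes′ : (i : Fin q) → Support a b p (toℕ i) → List (Hyp P q)
      hyperplanes′ i (corner ex ey)     = fixX i (sideX ex) ∷ fixY i (sideY ey) ∷ []
      hyperplanes′ i (on-side k<i ex _) = fixX i (sideX ex) ∷ attack i (earlier {i} k<i) (earlier-≢ k<i) Fin.zero ∷ []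
      hyperplanes′ i (on-base k<i ey _) = fixY i (sideY ey) ∷ attack i (earlier {i} k<i) (earlier-≢ k<i) (Fin.suc Fin.zero) ∷ []
      hyperplanes′ i (meeting k<i k′<i _ _) = attack i (earlier {i} k<i) (earlier-≢ k<i) Fin.zero ∷
        attack i (earlier {i} k′<i) (earlier-≢ k′<i) (Fin.suc Fin.zero) ∷ []

      hyperplanes : Fin q → List (Hyp P q)
      hyperplanes i = hyperplanes′ i (support (toℕ i))

      fixedX : ∀ {x} (e : Edge x) → 1ℚ - x ≡ b2q P (sideX e)
      fixedX (inj₁ refl) = refl
      fixedX (inj₂ refl) = refl

      fixedY : ∀ {y} (e : Edge y) → y ≡ b2q P (sideY e)
      fixedY (inj₁ refl) = refl
      fixedY (inj₂ refl) = refl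

      t-config : ∀ i → t (config i) ≡ line a (p (toℕ i))
      t-config i = cong (line a) (mirror² (p (toℕ i)))

      s-config : ∀ i → s (config i) ≡ line b (swap (p (toℕ i)))
      s-config i = cong (line b ∘ swap) (mirror² (p (toℕ i)))

      t-linked : ∀ {i k} (k<i : k ℕ.< toℕ i) → line a (p (toℕ i)) ≡ line a (p k) →
        t (config i) ≡ t (config (earlier {i} k<i))
      t-linked {i} k<i e = trans (t-config i) (trans e
        (trans (cong (line a ∘ p) (sym (toℕ-earlier {i} k<i))) (sym (t-config (earlier {i} k<i)))))

      s-linked : ∀ {i k} (k<i : k ℕ.< toℕ i) → line b (swap (p (toℕ i))) ≡ line b (swap (p k)) →
        s (config i) ≡ s (config (earlier {i} k<i))
      s-linked {i} k<i e = trans (s-config i) (trans e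
        (trans (cong (line b ∘ swap ∘ p) (sym (toℕ-earlier {i} k<i))) (sym (s-config (earlier {i} k<i)))))

      on′ : ∀ i σ → All (OnHyp P config) (hyperplanes′ i σ)
      on′ i (corner ex ey)     = fixedX ex ∷ fixedY ey ∷ []
      on′ i (on-side k<i ex e) = fixedX ex ∷ attack₁⇐ config i (earlier {i} k<i) {earlier-≢ k<i} (t-linked k<i e) ∷ []
      on′ i (on-base k<i ey e) = fixedY ey ∷ attack₂⇐ config i (earlier {i} k<i) {earlier-≢ k<i} {Fin.zero} (s-linked k<i e) ∷ []
      on′ i (meeting k<i k′<i e e′) = attack₁⇐ config i (earlier {i} k<i) {earlier-≢ k<i} (t-linked k<i e) ∷
        attack₂⇐ config i (earlier {i} k′<i) {earlier-≢ k′<i} {Fin.zero} (s-linked k′<i e′) ∷ []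

      determined : (w : Config P q) → ∀ i σ → (∀ j → toℕ j ℕ.< toℕ i → w j ≡ config j) →
        All (OnHyp P w) (hyperplanes′ i σ) → w i ≡ config i
      determined w i σ before h with σ
      determined w i σ before (hx ∷ hy ∷ []) | corner ex ey =
        cong₂ _,_ (trans hx (sym (fixedX ex))) (trans hy (sym (fixedY ey)))
      determined w i σ before (hx ∷ ha ∷ []) | on-side k<i ex e = side-determines
        (trans (attack₁⇒ w i (earlier {i} k<i) {earlier-≢ k<i} ha)
          (trans (cong t (before (earlier {i} k<i) (subst (ℕ._< toℕ i) (sym (toℕ-earlier {i} k<i)) k<i))) (sym (t-linked k<i e))))
        (trans hx (sym (fixedX ex)))
      determined w i σ before (hy ∷ ha ∷ []) | on-base k<i ey e = base-determines
        (trans (attack₂⇒ w i (earlier {i} k<i) {earlier-≢ k<i} {Fin.zero} ha)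
          (trans (cong s (before (earlier {i} k<i) (subst (ℕ._< toℕ i) (sym (toℕ-earlier {i} k<i)) k<i))) (sym (s-linked k<i e))))
        (trans hy (sym (fixedY ey)))
      determined w i σ before (h ∷ h′ ∷ []) | meeting k<i k′<i e e′ = lines-determine
        (trans (attack₁⇒ w i (earlier {i} k<i) {earlier-≢ k<i} h)
          (trans (cong t (before (earlier {i} k<i) (subst (ℕ._< toℕ i) (sym (toℕ-earlier {i} k<i)) k<i))) (sym (t-linked k<i e))))
        (trans (attack₂⇒ w i (earlier {i} k′<i) {earlier-≢ k′<i} {Fin.zero} h′)
          (trans (cong s (before (earlier {i} k′<i) (subst (ℕ._< toℕ i) (sym (toℕ-earlier {i} k′<i)) k′<i))) (sym (s-linked k′<i e′))))

    opaque

      config-isVertex : IsVertex P config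
      config-isVertex = in-box , concat (tabulate hyperplanes) ,
        All.concat⁺ (All.tabulate⁺ (λ i → on′ i (support (toℕ i)))) , unique
        where
        in-box : InBox P config
        in-box i = let (0≤x , x≤1) , (0≤y , y≤1) = box (toℕ i) ; (l , u) = Unit-1- (0≤x , x≤1) in l , u , 0≤y , y≤1
        unique : (w : Config P q) → All (OnHyp P w) (concat (tabulate hyperplanes)) → ∀ i → w i ≡ config i
        -- Strong induction on the index: `determined` places piece `i` once all earlier ones are in
        -- place.
        unique w h i = below (suc (toℕ i)) i (ℕ.n<1+n (toℕ i))
          where
          h′ : ∀ i → All (OnHyp P w) (hyperplanes i)
          h′ = All.tabulate⁻ (All.concat⁻ h)
          below : ∀ m i → toℕ i ℕ.< m → w i ≡ config i
          below (suc m) i (s≤s i≤m) = determined w i (support (toℕ i))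
            (λ j j<i → below m j (ℕ.<-≤-trans j<i i≤m)) (h′ i)

-- Vertices built from bounces

data Link (a b : ℚ) (p p′ : Pt) : Set where
  to-side : proj₁ p′ ≡ 0ℚ → line a p′ ≡ line a p → Link a b p p′
  to-base : proj₂ p′ ≡ 0ℚ → line b (swap p′) ≡ line b (swap p) → Link a b p p′

_·_ : ℚ → Pt → Pt
c · (x , y) = (c * x , c * y)

-- Successive bounces of the trajectory from `(1,0)`. Two bounces amount to scaling by `a b`, so
-- properties stable under homothety pass from the first points to all.
corners : ℚ → ℚ → ℕ → Pt
corners a b 0 = (1ℚ , 0ℚ)
corners a b 1 = (0ℚ , a)
corners a b (suc (suc n)) = (a * b) · corners a b n

-- The trajectories of both corners, interleaved: (ℓ b a j , 0) at index 2j
-- and (0 , ℓ a b j) at index 2j + 1.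
alternating : ℚ → ℚ → ℕ → Pt
alternating a b 0 = (1ℚ , 0ℚ)
alternating a b 1 = (0ℚ , 1ℚ)
alternating a b 2 = (b , 0ℚ)
alternating a b 3 = (0ℚ , a)
alternating a b (suc (suc (suc (suc n)))) = (a * b) · alternating a b n

opaque

  Link-swap : ∀ {a b p p′} → Link b a p p′ → Link a b (swap p) (swap p′)
  Link-swap (to-side e h) = to-base e h
  Link-swap (to-base e h) = to-side e h

  line-· : ∀ c a p → line a (c · p) ≡ c * line a p
  line-· c a (x , y) = lemma a c x y
    where
    lemma : ∀ a c x y → c * y + a * (c * x) ≡ c * (y + a * x)
    lemma = solve-∀ ℚ-ring

  Link-· : ∀ c {a b p p′} → Link a b p p′ → Link a b (c · p) (c · p′)
  Link-· c {a} {b} {p} {p′} (to-side e h) = to-side (trans (cong (c *_) e) (*-zeroʳ c))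
    (trans (line-· c a p′) (trans (cong (c *_) h) (sym (line-· c a p))))
  Link-· c {a} {b} {p} {p′} (to-base e h) = to-base (trans (cong (c *_) e) (*-zeroʳ c))
    (trans (line-· c b (swap p′)) (trans (cong (c *_) h) (sym (line-· c b (swap p)))))

  Link⇒Support : ∀ {a b p m k} → k ℕ.< m → Link a b (p k) (p m) → Support a b p m
  Link⇒Support k<m (to-side e h) = on-side k<m (inj₁ e) h
  Link⇒Support k<m (to-base e h) = on-base k<m (inj₁ e) h

  Unit-* : ∀ {c x} → Unit c → Unit x → Unit (c * x)
  Unit-* {c} {x} (0≤c , c≤1) (0≤x , x≤1) = 0≤* 0≤c 0≤x ,
    ≤-by (0≤+ (≤⇒0≤ c≤1) (0≤* 0≤c (≤⇒0≤ x≤1))) (lemma c x)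
    where
    lemma : ∀ c x → (1ℚ - c) + c * (1ℚ - x) ≡ 1ℚ - c * x
    lemma = solve-∀ ℚ-ring

  Box-· : ∀ {c p} → Unit c → Box p → Box (c · p)
  Box-· uc (ux , uy) = Unit-* uc ux , Unit-* uc uy

  unit-0 : Unit 0ℚ
  unit-0 = ≤-refl , <⇒≤ 0<1

  unit-1 : Unit 1ℚ
  unit-1 = <⇒≤ 0<1 , ≤-refl

  unit-a : ∀ {a b} → Slopes a b → Unit a
  unit-a S = <⇒≤ (Slopes.0<a S) , <⇒≤ (Slopes.a<1 S)

  unit-r : ∀ {a b} → Slopes a b → Unit (a * b)
  unit-r S = <⇒≤ (Slopes.0<r S) , <⇒≤ (Slopes.r<1 S)

  corners-link : ∀ a b n → Link a b (corners a b n) (corners a b (suc n))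
  corners-link a b 0 = to-side refl (lemma a)
    where
    lemma : ∀ a → a + a * 0ℚ ≡ 0ℚ + a * 1ℚ
    lemma = solve-∀ ℚ-ring
  corners-link a b 1 = to-base (*-zeroʳ (a * b)) (lemma a b)
    where
    lemma : ∀ a b → a * b * 1ℚ + b * (a * b * 0ℚ) ≡ 0ℚ + b * a
    lemma = solve-∀ ℚ-ring
  corners-link a b (suc (suc n)) = Link-· (a * b) (corners-link a b n)

  corners-support : ∀ a b m → Support a b (corners a b) m
  corners-support a b zero    = corner (inj₂ refl) (inj₁ refl)
  corners-support a b (suc m) = Link⇒Support (ℕ.n<1+n m) (corners-link a b m)

  corners-support′ : ∀ a b m → Support a b (swap ∘ corners b a) m
  corners-support′ a b zero    = corner (inj₁ refl) (inj₂ refl)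
  corners-support′ a b (suc m) = Link⇒Support (ℕ.n<1+n m) (Link-swap (corners-link b a m))

  corners-box : ∀ {a b} → Slopes a b → ∀ m → Box (corners a b m)
  corners-box S 0 = unit-1 , unit-0
  corners-box S 1 = unit-0 , unit-a S
  corners-box S (suc (suc m)) = Box-· (unit-r S) (corners-box S m)

  corners-coordinate : ∀ a b n → proj₁ (corners a b n) ≡ ℓ a b n ⊎ proj₂ (corners a b n) ≡ ℓ a b n
  corners-coordinate a b 0 = inj₁ refl
  corners-coordinate a b 1 = inj₂ (sym (*-identityʳ a))
  corners-coordinate a b (suc (suc n)) with corners-coordinate a b n
  ... | inj₁ e = inj₁ (trans (cong (a * b *_) e) (*-assoc a b _))
  ... | inj₂ e = inj₂ (trans (cong (a * b *_) e) (*-assoc a b _))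

  -- Each bounce hangs on the preceding one of its own trajectory, which lies on the other axis:
  -- index `2 j + 2` on `2 j + 1`, index `2 j + 3` on `2 j`.
  alternating-link : ∀ a b n → ∃ λ k → k ℕ.< suc (suc n) ×
    Link a b (alternating a b k) (alternating a b (suc (suc n)))
  alternating-link a b 0 = 1 , s≤s (s≤s z≤n) , to-base refl (lemma b)
    where
    lemma : ∀ b → b + b * 0ℚ ≡ 0ℚ + b * 1ℚ
    lemma = solve-∀ ℚ-ring
  alternating-link a b 1 = 0 , s≤s z≤n , to-side refl (lemma a)
    where
    lemma : ∀ b → b + b * 0ℚ ≡ 0ℚ + b * 1ℚ
    lemma = solve-∀ ℚ-ring
  alternating-link a b 2 = 3 , ℕ.≤-refl , to-base (*-zeroʳ (a * b)) (lemma a b)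
    where
    lemma : ∀ a b → a * b * 1ℚ + b * (a * b * 0ℚ) ≡ 0ℚ + b * a
    lemma = solve-∀ ℚ-ring
  alternating-link a b 3 = 2 , s≤s (s≤s (s≤s z≤n)) , to-side (*-zeroʳ (a * b)) (lemma a b)
    where
    lemma : ∀ a b → a * b * 1ℚ + a * (a * b * 0ℚ) ≡ 0ℚ + a * b
    lemma = solve-∀ ℚ-ring
  alternating-link a b (suc (suc (suc (suc n)))) =
    let k , k<2+n , link = alternating-link a b n
    in 4 ℕ.+ k , ℕ.+-monoʳ-< 4 k<2+n , Link-· (a * b) link

  alternating-box : ∀ {a b} → Slopes a b → ∀ m → Box (alternating a b m)
  alternating-box S 0 = unit-1 , unit-0
  alternating-box S 1 = unit-0 , unit-1
  alternating-box S 2 = unit-a (Slopes-swap S) , unit-0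
  alternating-box S 3 = unit-0 , unit-a S
  alternating-box S (suc (suc (suc (suc m)))) = Box-· (unit-r S) (alternating-box S m)

double : ℕ → ℕ
double zero    = zero
double (suc n) = suc (suc (double n))

opaque

  double≡ : ∀ n → double n ≡ 2 ℕ.* n
  double≡ zero = refl
  double≡ (suc n) = trans (cong (suc ∘ suc) (double≡ n)) (sym (ℕ.*-suc 2 n))

  alternating-even : ∀ a b n → alternating a b (double n) ≡ (ℓ b a n , 0ℚ)
  alternating-even a b 0 = refl
  alternating-even a b 1 = cong (_, 0ℚ) (sym (*-identityʳ b))
  alternating-even a b (suc (suc n)) =
    trans (cong ((a * b) ·_) (alternating-even a b n)) (cong₂ _,_ (lemma a b _) (*-zeroʳ (a * b)))
    where
    lemma : ∀ a b x → a * b * x ≡ b * (a * x)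
    lemma = solve-∀ ℚ-ring

  alternating-odd : ∀ a b n → alternating a b (suc (double n)) ≡ (0ℚ , ℓ a b n)
  alternating-odd a b 0 = refl
  alternating-odd a b 1 = cong (0ℚ ,_) (sym (*-identityʳ a))
  alternating-odd a b (suc (suc n)) =
    trans (cong ((a * b) ·_) (alternating-odd a b n)) (cong₂ _,_ (*-zeroʳ (a * b)) (*-assoc a b _))

module Meeting {a b : ℚ} (S : Slopes a b) (n : ℕ) (p : Pt)
  (t≡ : line a p ≡ ℓ a b (suc n)) (s≡ : line b (swap p) ≡ ℓ b a (suc n)) where
  open Slopes S

  -- The first `2 (n + 1)` bounces, then the meeting point, repeated because a support is required
  -- at every index.
  points : ℕ → Pt
  points m with m ℕ.<? double (suc n)
  ... | yes _ = alternating a b m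
  ... | no  _ = p

  opaque

    points-low : ∀ {m} → m ℕ.< double (suc n) → points m ≡ alternating a b m
    points-low {m} h with m ℕ.<? double (suc n)
    ... | yes _ = refl
    ... | no h′ = ⊥-elim (h′ h)

    points-last : points (double (suc n)) ≡ p
    points-last with double (suc n) ℕ.<? double (suc n)
    ... | yes h = ⊥-elim (ℕ.<-irrefl refl h)
    ... | no _  = refl

    private
      ℓ≤1 : ∀ {a b} → Slopes a b → ∀ n → ℓ a b n ≤ 1ℚ
      ℓ≤1 S zero    = ≤-refl
      ℓ≤1 S (suc n) = <⇒≤ (ℓ-antitone S (suc n) (s≤s z≤n))

      coordinate-nonneg : ∀ {a b} → Slopes a b → ∀ {x y} → line a (x , y) ≡ ℓ a b (suc n) →
        line b (y , x) ≡ ℓ b a (suc n) → 0ℚ ≤ x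
      coordinate-nonneg {a} {b} S {x} {y} t s = *-cancelˡ-≤ (1ℚ - a * b) (Slopes.0<1-r S)
        (subst₂ _≤_ (sym (*-zeroʳ (1ℚ - a * b))) (trans (cong₂ (λ s t → s - b * t) (sym s) (sym t)) (lemma a b x y))
          (≤⇒0≤ (<⇒≤ (ℓ-step (Slopes-swap S) (suc n)))))
        where
        lemma : ∀ a b x y → x + b * y - b * (y + a * x) ≡ (1ℚ - a * b) * x
        lemma = solve-∀ ℚ-ring

      coordinate-≤1 : ∀ {a b} → Slopes a b → ∀ {x y} → 0ℚ ≤ x → line a (x , y) ≡ ℓ a b (suc n) → y ≤ 1ℚ
      coordinate-≤1 {a} S {x} {y} 0≤x t = ≤-trans (≤-by (0≤* (<⇒≤ (Slopes.0<a S)) 0≤x) (lemma a x y))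
        (subst (_≤ 1ℚ) (sym t) (ℓ≤1 S (suc n)))
        where
        lemma : ∀ a x y → a * x ≡ (y + a * x) - y
        lemma = solve-∀ ℚ-ring

    -- `(1 - a b) x` is the difference of two successive values of `ℓ b a`, hence nonnegative, and
    -- symmetrically for `y`; since `ℓ` is at most `1`, the upper bounds follow.
    p-box : Box p
    p-box = (0≤x , coordinate-≤1 (Slopes-swap S) 0≤y s≡) , (0≤y , coordinate-≤1 S 0≤x t≡)
      where
      0≤x : 0ℚ ≤ proj₁ p
      0≤x = coordinate-nonneg S t≡ s≡
      0≤y : 0ℚ ≤ proj₂ p
      0≤y = coordinate-nonneg (Slopes-swap S) s≡ t≡

    points-box : ∀ m → Box (points m)
    points-box m with m ℕ.<? double (suc n)
    ... | yes _ = alternating-box S m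
    ... | no  _ = p-box

    private
      even-line : line a (points (double n)) ≡ ℓ a b (suc n)
      even-line = trans (cong (line a) (trans (points-low (ℕ.m<n⇒m<1+n (ℕ.n<1+n _))) (alternating-even a b n)))
        (+-identityˡ _)

      odd-line : line b (swap (points (suc (double n)))) ≡ ℓ b a (suc n)
      odd-line = trans (cong (line b ∘ swap) (trans (points-low (ℕ.n<1+n _)) (alternating-odd a b n)))
        (+-identityˡ _)

      cast-link : ∀ {p p′ q q′} → p ≡ q → p′ ≡ q′ → Link a b q q′ → Link a b p p′
      cast-link refl refl l = l

      low-support : ∀ m → m ℕ.< double (suc n) → Support a b points m
      low-support 0 h = corner (inj₂ (cong proj₁ (points-low h))) (inj₁ (cong proj₂ (points-low h)))
      low-support 1 h = corner (inj₁ (cong proj₁ (points-low h))) (inj₂ (cong proj₂ (points-low h)))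
      low-support (suc (suc m)) h =
        let k , k<2+m , link = alternating-link a b m
        in Link⇒Support k<2+m (cast-link (points-low (ℕ.<-trans k<2+m h)) (points-low h) link)

      -- The last bounce on either axis carries one of the two lines of index `n + 1` through `p`.
      high-support : ∀ m → double (suc n) ℕ.≤ m → points m ≡ p → Support a b points m
      high-support m h e = meeting {k = double n} {k′ = suc (double n)}
        (ℕ.<-≤-trans (ℕ.m<n⇒m<1+n (ℕ.n<1+n _)) h) (ℕ.<-≤-trans (ℕ.n<1+n _) h)
        (trans (trans (cong (line a) e) t≡) (sym even-line))
        (trans (trans (cong (line b ∘ swap) e) s≡) (sym odd-line))

      points-high : ∀ {m} → ¬ (m ℕ.< double (suc n)) → points m ≡ p
      points-high {m} h with m ℕ.<? double (suc n)
      ... | yes h′ = ⊥-elim (h h′)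
      ... | no _   = refl

    points-support : ∀ m → Support a b points m
    points-support m with ℕ._<?_ m (double (suc n))
    ... | yes h = low-support m h
    ... | no h  = high-support m (ℕ.≮⇒≥ h) (points-high h)

-- Least common multiples of denominators

module _ {D : ℕ} where opaque

  denPt-least : ∀ p → DenominatorsDivide D p → denPt p ∣ D
  denPt-least (x , y) (dx , dy) = lcm-least dx dy

  denPt-divides : ∀ p → denPt p ∣ D → DenominatorsDivide D p
  denPt-divides (x , y) h = ∣-trans (m∣lcm[m,n] (↧ₙ x) (↧ₙ y)) h , ∣-trans (n∣lcm[m,n] (↧ₙ x) (↧ₙ y)) h

  denConfig-least : ∀ P {q} (z : Config P q) → (∀ i → DenominatorsDivide D (z i)) → denConfig P z ∣ D
  denConfig-least P {zero}  z h = 1∣ D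
  denConfig-least P {suc q} z h = lcm-least (denPt-least (z Fin.zero) (h Fin.zero))
    (denConfig-least P (λ i → z (Fin.suc i)) (λ i → h (Fin.suc i)))

  denConfig-divides : ∀ P {q} (z : Config P q) → denConfig P z ∣ D → ∀ i → DenominatorsDivide D (z i)
  denConfig-divides P z h Fin.zero = denPt-divides (z Fin.zero)
    (∣-trans (m∣lcm[m,n] (denPt (z Fin.zero)) (denConfig P (λ i → z (Fin.suc i)))) h)
  denConfig-divides P z h (Fin.suc i) = denConfig-divides P (λ i → z (Fin.suc i))
    (∣-trans (n∣lcm[m,n] (denPt (z Fin.zero)) (denConfig P (λ i → z (Fin.suc i)))) h) i

  mirror-divides⁻ : ∀ p → DenominatorsDivide D (mirror p) → DenominatorsDivide D p
  mirror-divides⁻ (x , y) (dx , dy) = denominator-1-⁻ x dx , dy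

module _ (f : ℕ → ℕ) where opaque

  private
    lcmAt : List ℕ → ℕ
    lcmAt xs = lcmList (map f xs)

    -- `foldr _∷_ (m ∷ []) xs` is `xs` with `m` appended, the form in which `range1` grows.
    snoc-last : ∀ m xs → f m ∣ lcmAt (foldr _∷_ (m ∷ []) xs)
    snoc-last m []       = m∣lcm[m,n] (f m) 1
    snoc-last m (x ∷ xs) = ∣-trans (snoc-last m xs) (n∣lcm[m,n] (f x) _)

    snoc-init : ∀ m xs → lcmAt xs ∣ lcmAt (foldr _∷_ (m ∷ []) xs)
    snoc-init m []       = 1∣ _
    snoc-init m (x ∷ xs) = lcm-least (m∣lcm[m,n] (f x) _)
      (∣-trans (snoc-init m xs) (n∣lcm[m,n] (f x) (lcmAt (foldr _∷_ (m ∷ []) xs))))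

    snoc-least : ∀ {N} m xs → lcmAt xs ∣ N → f m ∣ N → lcmAt (foldr _∷_ (m ∷ []) xs) ∣ N
    snoc-least m []       _ h = lcm-least h (1∣ _)
    snoc-least m (x ∷ xs) h h′ = lcm-least (∣-trans (m∣lcm[m,n] (f x) (lcmAt xs)) h)
      (snoc-least m xs (∣-trans (n∣lcm[m,n] (f x) (lcmAt xs)) h) h′)

  range1-divides : ∀ n {m} → m ℕ.< n → f (suc m) ∣ lcmList (map f (range1 n))
  range1-divides (suc n) {m} m<1+n with ℕ.m<1+n⇒m<n∨m≡n m<1+n
  ... | inj₁ m<n  = ∣-trans (range1-divides n m<n) (snoc-init (suc n) (range1 n))
  ... | inj₂ refl = snoc-last (suc n) (range1 n)

  range1-least : ∀ n {N} → (∀ m → m ℕ.< n → f (suc m) ∣ N) → lcmList (map f (range1 n)) ∣ N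
  range1-least zero    h = 1∣ _
  range1-least (suc n) h = snoc-least (suc n) (range1 n)
    (range1-least n (λ m m<n → h m (ℕ.m<n⇒m<1+n m<n))) (h n (ℕ.n<1+n n))

-- The two sequences

term : (odd even : ℕ → Pt) → ℕ → ℕ → Pt
term odd even zero                k = (0ℚ , 0ℚ)
term odd even (suc zero)          k = odd k
term odd even (suc (suc zero))    k = even k
term odd even (suc (suc (suc j))) k = term odd even (suc j) (suc k)

-- The recursion inside byParity has no name in scope: it is recovered by
-- unification once its index and its two arguments are distinct variables.
mutual

  go : Moves → (ℕ → Pt) → (ℕ → Pt) → ℕ → ℕ → ℕ → Pt
  go = _

  byParity≡go : ∀ P odd even j →
    byParity P odd even (suc (suc (suc j))) ≡ go P odd even (suc (suc (suc j))) (suc j) 1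
  byParity≡go P odd even j with suc (suc (suc j))
  ... | i with suc j | 1
  ... | m | k = refl

go≡term : ∀ P odd even i n k → go P odd even i n k ≡ term odd even n k
go≡term P odd even i zero                k = refl
go≡term P odd even i (suc zero)          k = refl
go≡term P odd even i (suc (suc zero))    k = refl
go≡term P odd even i (suc (suc (suc n))) k = go≡term P odd even i (suc n) (suc k)

byParity≡term : ∀ P odd even n → byParity P odd even n ≡ term odd even n 0
byParity≡term P odd even n = go≡term P odd even n n 0

opaque

  /'-* : ∀ p {q} → q ≢ 0ℚ → (p /' q) * q ≡ p
  /'-* p {q} q≢0 with q ≟ 0ℚ
  ... | yes q≡0 = ⊥-elim (q≢0 q≡0)
  ... | no q≢0′ = trans (*-assoc p (1/ q) q) (trans (cong (p *_) (*-inverseˡ q)) (*-identityʳ p))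
    where
    instance
      q-nonZero : NonZero q
      q-nonZero = ≢-nonZero q≢0′

  *-≢0 : ∀ {p q} → p ≢ 0ℚ → q ≢ 0ℚ → p * q ≢ 0ℚ
  *-≢0 {p} p≢0 q≢0 e = q≢0 (*-cancelˡ p p≢0 (trans e (sym (*-zeroʳ p))))

module Sequences (P : Moves) {a b : ℚ} (S : Slopes a b)
  (c₁≢0 : ⟦ Moves.c₁ P ⟧ ≢ 0ℚ) (d₂≢0 : ⟦ Moves.d₂ P ⟧ ≢ 0ℚ)
  (d₁≡ : ⟦ Moves.d₁ P ⟧ ≡ a * ⟦ Moves.c₁ P ⟧) (c₂≡ : ⟦ Moves.c₂ P ⟧ ≡ b * ⟦ Moves.d₂ P ⟧)
  (a≡ : ⟦ Moves.d₁ P ⟧ /' ⟦ Moves.c₁ P ⟧ ≡ a) (b≡ : ⟦ Moves.c₂ P ⟧ /' ⟦ Moves.d₂ P ⟧ ≡ b)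
  where
  open Moves P
  open Slopes S

  oddA evenA oddB evenB : ℕ → Pt
  oddA  k = (1ℚ , ratio P ^' k)
  evenA k = scale P (ratio P ^' k) (⟦ d₁ ⟧ /' ⟦ c₁ ⟧ , ⟦ c₂ ⟧ /' ⟦ d₂ ⟧)
  oddB  k = scale P (ratio P ^' k)
    ( (⟦ c₂ ⟧ * (⟦ d₁ ⟧ - ⟦ c₁ ⟧)) /' Δ P
    , (⟦ d₁ ⟧ * (⟦ d₂ ⟧ - ⟦ c₂ ⟧)) /' Δ P )
  evenB k = scale P (ratio P ^' suc k)
    ( (⟦ c₁ ⟧ * (⟦ c₂ ⟧ - ⟦ d₂ ⟧)) /' Δ P
    , (⟦ d₂ ⟧ * (⟦ c₁ ⟧ - ⟦ d₁ ⟧)) /' Δ P )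

  -- Here `n` counts from zero. Odd terms of the first sequence have first coordinate `1` in place
  -- of `ℓ a b n`; no denominator is lost, since then `ℓ a b n` and `ℓ b a n` coincide. The power of
  -- the ratio is what `term` has accumulated.
  ValueA : ℕ → ℕ → Pt → Set
  ValueA n k (x , y) = y ≡ ratio P ^' k * ℓ b a n ×
    (x ≡ ratio P ^' k * ℓ a b n ⊎ x ≡ 1ℚ × ℓ a b n ≡ ℓ b a n)

  opaque

    private
      ratio≡ : ratio P ≡ a * b
      ratio≡ = *-cancelˡ (⟦ c₁ ⟧ * ⟦ d₂ ⟧) (*-≢0 c₁≢0 d₂≢0)
        (trans (*-comm (⟦ c₁ ⟧ * ⟦ d₂ ⟧) (ratio P)) (trans (/'-* (⟦ d₁ ⟧ * ⟦ c₂ ⟧) (*-≢0 c₁≢0 d₂≢0))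
          (trans (cong₂ _*_ d₁≡ c₂≡) (lemma a b ⟦ c₁ ⟧ ⟦ d₂ ⟧))))
        where
        lemma : ∀ a b c d → a * c * (b * d) ≡ c * d * (a * b)
        lemma = solve-∀ ℚ-ring

      Δ≡ : Δ P ≡ ⟦ c₁ ⟧ * ⟦ d₂ ⟧ * (1ℚ - a * b)
      Δ≡ = trans (cong₂ (λ d c → ⟦ c₁ ⟧ * ⟦ d₂ ⟧ - c * d) d₁≡ c₂≡) (lemma a b ⟦ c₁ ⟧ ⟦ d₂ ⟧)
        where
        lemma : ∀ a b c d → c * d - b * d * (a * c) ≡ c * d * (1ℚ - a * b)
        lemma = solve-∀ ℚ-ring

      Δ≢0 : Δ P ≢ 0ℚ
      Δ≢0 e = *-≢0 (*-≢0 c₁≢0 d₂≢0) (0<⇒≢0 0<1-r) (trans (sym Δ≡) e)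

      ratio-shift : ∀ c d → a * b ≡ c * d → ∀ k x → ratio P ^' suc k * x ≡ ratio P ^' k * (c * (d * x))
      ratio-shift c d ab≡cd k x = trans (cong (λ r → r * ratio P ^' k * x) (trans ratio≡ ab≡cd))
        (lemma c d (ratio P ^' k) x)
        where
        lemma : ∀ a b r x → a * b * r * x ≡ r * (a * (b * x))
        lemma = solve-∀ ℚ-ring

    seqA-value : ∀ n k → ValueA n k (term oddA evenA (suc n) k)
    seqA-value 0 k = sym (*-identityʳ _) , inj₂ (refl , refl)
    seqA-value 1 k = cong (ratio P ^' k *_) (trans b≡ (sym (*-identityʳ b))) ,
      inj₁ (cong (ratio P ^' k *_) (trans a≡ (sym (*-identityʳ a))))
    seqA-value (suc (suc n)) k with seqA-value n (suc k)
    ... | e , e′ = trans e (ratio-shift b a (*-comm a b) k _) , next e′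
      where
      next : ∀ {x} → x ≡ ratio P * ratio P ^' k * ℓ a b n ⊎ x ≡ 1ℚ × ℓ a b n ≡ ℓ b a n →
        x ≡ ratio P ^' k * (a * (b * ℓ a b n)) ⊎ x ≡ 1ℚ × a * (b * ℓ a b n) ≡ b * (a * ℓ b a n)
      next (inj₁ e) = inj₁ (trans e (ratio-shift a b refl k _))
      next (inj₂ (e , e′)) = inj₂ (e , trans (lemma a b (ℓ a b n)) (cong (λ x → b * (a * x)) e′))
        where
        lemma : ∀ a b x → a * (b * x) ≡ b * (a * x)
        lemma = solve-∀ ℚ-ring

  -- The first coordinates in the second sequence are the negatives of the
  -- distances of the intersection points to the side x = 1.
  reflect : Pt → Pt
  reflect (x , y) = (- x , y)

  opaque

    private
      scaled-line : ∀ a c p → line a (reflect (scale P c p)) ≡ c * line a (reflect p)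
      scaled-line a c (x , y) = lemma a c x y
        where
        lemma : ∀ a c x y → c * y + a * (- (c * x)) ≡ c * (y + a * (- x))
        lemma = solve-∀ ℚ-ring

      scaled-line′ : ∀ b c p → line b (swap (reflect (scale P c p))) ≡ c * line b (swap (reflect p))
      scaled-line′ b c (x , y) = lemma b c x y
        where
        lemma : ∀ b c x y → - (c * x) + b * (c * y) ≡ c * (- x + b * y)
        lemma = solve-∀ ℚ-ring

      quotients : ℚ → ℚ → Pt
      quotients m n = (m /' Δ P , n /' Δ P)

      quotient-line : ∀ m n {w} → n + a * (- m) ≡ Δ P * w → line a (reflect (quotients m n)) ≡ w
      quotient-line m n e = *-cancelˡ (Δ P) Δ≢0 (trans (lemma a (Δ P) (m /' Δ P) (n /' Δ P))
        (trans (cong₂ (λ m n → n + a * (- m)) (/'-* m Δ≢0) (/'-* n Δ≢0)) e))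
        where
        lemma : ∀ a δ u v → δ * (v + a * (- u)) ≡ v * δ + a * (- (u * δ))
        lemma = solve-∀ ℚ-ring

      quotient-line′ : ∀ m n {w} → - m + b * n ≡ Δ P * w → line b (swap (reflect (quotients m n))) ≡ w
      quotient-line′ m n e = *-cancelˡ (Δ P) Δ≢0 (trans (lemma b (Δ P) (m /' Δ P) (n /' Δ P))
        (trans (cong₂ (λ m n → - m + b * n) (/'-* m Δ≢0) (/'-* n Δ≢0)) e))
        where
        lemma : ∀ b δ u v → δ * (- u + b * v) ≡ - (u * δ) + b * (v * δ)
        lemma = solve-∀ ℚ-ring

      -- Eliminates `d₁`, `c₂` and `Δ`, turning each formula of the second sequence into a
      -- polynomial identity in `a`, `b`, `c₁` and `d₂`.
      substitute : (F : ℚ → ℚ → ℚ → ℚ → ℚ) (w : ℚ) →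
        (∀ c₁ d₂ → F c₁ (a * c₁) (b * d₂) d₂ ≡ c₁ * d₂ * (1ℚ - a * b) * w) →
        F ⟦ c₁ ⟧ ⟦ d₁ ⟧ ⟦ c₂ ⟧ ⟦ d₂ ⟧ ≡ Δ P * w
      substitute F w h = trans (cong₂ (λ d c → F ⟦ c₁ ⟧ d c ⟦ d₂ ⟧) d₁≡ c₂≡)
        (trans (h ⟦ c₁ ⟧ ⟦ d₂ ⟧) (cong (_* w) (sym Δ≡)))

    -- Identifies a term by the two lines through it, which determine the point: term `n + 1` is the
    -- meeting of index `n + 1`, up to the factor accumulated in `term`.
    seqB-lines : ∀ n k →
      line a (reflect (term oddB evenB (suc n) k)) ≡ ratio P ^' k * ℓ a b (suc n) ×
      line b (swap (reflect (term oddB evenB (suc n) k))) ≡ ratio P ^' k * ℓ b a (suc n)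
    seqB-lines 0 k =
      trans (scaled-line a (ratio P ^' k) (quotients _ _)) (cong (ratio P ^' k *_)
        (quotient-line (⟦ c₂ ⟧ * (⟦ d₁ ⟧ - ⟦ c₁ ⟧)) (⟦ d₁ ⟧ * (⟦ d₂ ⟧ - ⟦ c₂ ⟧))
          (substitute (λ c₁ d₁ c₂ d₂ → d₁ * (d₂ - c₂) + a * (- (c₂ * (d₁ - c₁)))) (a * 1ℚ) (lemma₁ a b)))) ,
      trans (scaled-line′ b (ratio P ^' k) (quotients _ _)) (cong (ratio P ^' k *_)
        (quotient-line′ (⟦ c₂ ⟧ * (⟦ d₁ ⟧ - ⟦ c₁ ⟧)) (⟦ d₁ ⟧ * (⟦ d₂ ⟧ - ⟦ c₂ ⟧))
          (substitute (λ c₁ d₁ c₂ d₂ → - (c₂ * (d₁ - c₁)) + b * (d₁ * (d₂ - c₂))) (b * 1ℚ) (lemma₂ a b))))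
      where
      lemma₁ : ∀ a b c d → a * c * (d - b * d) + a * (- (b * d * (a * c - c))) ≡
        c * d * (1ℚ - a * b) * (a * 1ℚ)
      lemma₁ = solve-∀ ℚ-ring
      lemma₂ : ∀ a b c d → - (b * d * (a * c - c)) + b * (a * c * (d - b * d)) ≡
        c * d * (1ℚ - a * b) * (b * 1ℚ)
      lemma₂ = solve-∀ ℚ-ring
    seqB-lines 1 k =
      trans (scaled-line a (ratio P ^' suc k) (quotients _ _)) (trans (cong (ratio P ^' suc k *_)
        (quotient-line (⟦ c₁ ⟧ * (⟦ c₂ ⟧ - ⟦ d₂ ⟧)) (⟦ d₂ ⟧ * (⟦ c₁ ⟧ - ⟦ d₁ ⟧))
          (substitute (λ c₁ d₁ c₂ d₂ → d₂ * (c₁ - d₁) + a * (- (c₁ * (c₂ - d₂)))) 1ℚ (lemma₁ a b))))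
        (ratio-shift a b refl k 1ℚ)) ,
      trans (scaled-line′ b (ratio P ^' suc k) (quotients _ _)) (trans (cong (ratio P ^' suc k *_)
        (quotient-line′ (⟦ c₁ ⟧ * (⟦ c₂ ⟧ - ⟦ d₂ ⟧)) (⟦ d₂ ⟧ * (⟦ c₁ ⟧ - ⟦ d₁ ⟧))
          (substitute (λ c₁ d₁ c₂ d₂ → - (c₁ * (c₂ - d₂)) + b * (d₂ * (c₁ - d₁))) 1ℚ (lemma₂ a b))))
        (ratio-shift b a (*-comm a b) k 1ℚ))
      where
      lemma₁ : ∀ a b c d → d * (c - a * c) + a * (- (c * (b * d - d))) ≡ c * d * (1ℚ - a * b) * 1ℚ
      lemma₁ = solve-∀ ℚ-ring
      lemma₂ : ∀ a b c d → - (c * (b * d - d)) + b * (d * (c - a * c)) ≡ c * d * (1ℚ - a * b) * 1ℚ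
      lemma₂ = solve-∀ ℚ-ring
    seqB-lines (suc (suc n)) k =
      let e , e′ = seqB-lines n (suc k)
      in trans e (ratio-shift a b refl k _) , trans e′ (ratio-shift b a (*-comm a b) k _)

  opaque

    valueA-divides : ∀ {N n p} → ValueA n 0 p → DenominatorsDivide N p → DenominatorsDivide N (ℓ a b n , ℓ b a n)
    valueA-divides {N} {n} (e , inj₁ e′) (dx , dy) =
      subst (λ x → ↧ₙ x ∣ N) (trans e′ (*-identityˡ (ℓ a b n))) dx , subst (λ y → ↧ₙ y ∣ N) (trans e (*-identityˡ (ℓ b a n))) dy
    valueA-divides {N} {n} (e , inj₂ (_ , ℓ≡ℓ)) (_ , dy) =
      subst (λ x → ↧ₙ x ∣ N) (trans e (trans (*-identityˡ (ℓ b a n)) (sym ℓ≡ℓ))) dy , subst (λ y → ↧ₙ y ∣ N) (trans e (*-identityˡ (ℓ b a n))) dy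

    valueA-divides⁻ : ∀ {N n p} → ValueA n 0 p → DenominatorsDivide N (ℓ a b n , ℓ b a n) → DenominatorsDivide N p
    valueA-divides⁻ {N} {n} (e , e′) (dx , dy) =
      first e′ , subst (λ y → ↧ₙ y ∣ N) (sym (trans e (*-identityˡ (ℓ b a n)))) dy
      where
      first : ∀ {x} → x ≡ 1ℚ * ℓ a b n ⊎ x ≡ 1ℚ × ℓ a b n ≡ ℓ b a n → ↧ₙ x ∣ N
      first (inj₁ e)       = subst (λ x → ↧ₙ x ∣ N) (sym (trans e (*-identityˡ (ℓ a b n)))) dx
      first (inj₂ (e , _)) = subst (λ x → ↧ₙ x ∣ N) (sym e) (1∣ N)

    seqLcm-bound : ∀ q → Bound a b q (seqLcm P q)
    seqLcm-bound q = record { boundary = boundary ; interior = interior }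
      where
      listA listB : ℕ
      listA = lcmList (map (λ i → denPt (seqA P i)) (range1 q))
      listB = lcmList (map (λ i → denPt (seqB P i)) (range1 ((q ∸ 1) ℕ./ 2)))
      boundary : ∀ n → n ℕ.< q → DenominatorsDivide (lcm listA listB) (ℓ a b n , ℓ b a n)
      boundary n n<q = valueA-divides {n = n} (seqA-value n 0)
        (denPt-divides (term oddA evenA (suc n) 0) (subst (λ p → denPt p ∣ lcm listA listB) (byParity≡term P oddA evenA (suc n))
          (∣-trans (range1-divides (λ i → denPt (seqA P i)) q n<q) (m∣lcm[m,n] listA listB))))
      interior : ∀ n → 1 ℕ.≤ n → suc (2 ℕ.* n) ℕ.≤ q → ∀ p →
        line a p ≡ ℓ a b n → line b (swap p) ≡ ℓ b a n → DenominatorsDivide (lcm listA listB) p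
      interior (suc n) _ 2n<q p t≡ s≡ = subst (DenominatorsDivide (lcm listA listB)) same-point
        (denominator-neg (proj₁ (term oddB evenB (suc n) 0)) (proj₁ term-divides) , proj₂ term-divides)
        where
        -- `2 (n + 1) + 1 ≤ q` amounts to `n + 1 ≤ ⌊(q - 1) / 2⌋`, the number of terms taken from
        -- the second sequence.
        n<half : n ℕ.< (q ∸ 1) ℕ./ 2
        n<half = subst (ℕ._≤ (q ∸ 1) ℕ./ 2) (ℕ.m*n/n≡m (suc n) 2)
          (ℕ./-monoˡ-≤ 2 (subst (ℕ._≤ q ∸ 1) (ℕ.*-comm 2 (suc n)) (ℕ.∸-monoˡ-≤ 1 2n<q)))
        term-divides : DenominatorsDivide (lcm listA listB) (term oddB evenB (suc n) 0)
        term-divides = denPt-divides (term oddB evenB (suc n) 0) (subst (λ p → denPt p ∣ lcm listA listB) (byParity≡term P oddB evenB (suc n))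
          (∣-trans (range1-divides (λ i → denPt (seqB P i)) ((q ∸ 1) ℕ./ 2) n<half) (n∣lcm[m,n] listA listB)))
        same-point : reflect (term oddB evenB (suc n) 0) ≡ p
        same-point = intersection-unique S
          (trans (proj₁ (seqB-lines n 0)) (trans (*-identityˡ (ℓ a b (suc n))) (sym t≡)))
          (trans (proj₂ (seqB-lines n 0)) (trans (*-identityˡ (ℓ b a (suc n))) (sym s≡)))

    seqLcm-least : ∀ q {N} → Bound a b q N → seqLcm P q ∣ N
    seqLcm-least q {N} B = lcm-least
      (range1-least (λ i → denPt (seqA P i)) q λ n n<q →
        subst (λ p → denPt p ∣ N) (sym (byParity≡term P oddA evenA (suc n))) (denPt-least (term oddA evenA (suc n) 0) (valueA-divides⁻ {n = n} (seqA-value n 0) (Bound.boundary B n n<q))))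
      (range1-least (λ i → denPt (seqB P i)) ((q ∸ 1) ℕ./ 2) λ n n<half →
        subst (λ p → denPt p ∣ N) (sym (byParity≡term P oddB evenB (suc n))) (denPt-least (term oddB evenB (suc n) 0) (termB n n<half)))
      where
      termB : ∀ n → n ℕ.< (q ∸ 1) ℕ./ 2 → DenominatorsDivide N (term oddB evenB (suc n) 0)
      termB n n<half = subst (λ x → ↧ₙ x ∣ N) (neg-neg x) (denominator-neg (- x) (proj₁ term-divides)) , proj₂ term-divides
        where
        x : ℚ
        x = proj₁ (term oddB evenB (suc n) 0)
        neg-neg : ∀ x → - (- x) ≡ x
        neg-neg = solve-∀ ℚ-ring
        -- The converse inequality; for `q = 0` no term is taken.
        bound : ∀ q → suc n ℕ.≤ (q ∸ 1) ℕ./ 2 → suc (2 ℕ.* suc n) ℕ.≤ q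
        bound zero ()
        bound (suc q) h = s≤s (ℕ.≤-trans (subst (2 ℕ.* suc n ℕ.≤_) (ℕ.*-comm 2 (q ℕ./ 2)) (ℕ.*-monoʳ-≤ 2 h))
          (ℕ.m/n*n≤m q 2))
        term-divides : DenominatorsDivide N (reflect (term oddB evenB (suc n) 0))
        term-divides = Bound.interior B (suc n) (s≤s z≤n) (bound q n<half) (reflect (term oddB evenB (suc n) 0))
          (trans (proj₁ (seqB-lines n 0)) (*-identityˡ (ℓ a b (suc n))))
          (trans (proj₂ (seqB-lines n 0)) (*-identityˡ (ℓ b a (suc n))))

    denominator-theorem : ∀ q → IsIOPDenominator P q (seqLcm P q)
    denominator-theorem q = upper , lower
      where
      open Vertices P S c₁≢0 d₂≢0 d₁≡ c₂≡
      upper : (z : Config P q) → IsVertex P z → denConfig P z ∣ seqLcm P q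
      upper z V = denConfig-least P z λ i → mirror-divides⁻ (z i)
        (piece-divides {z = mirror ∘ z} S (seqLcm-bound q) (vertex⇒rigid z V) box i)
        where
        box : ∀ i → Box (mirror (z i))
        box i = let 0≤x , x≤1 , uy = proj₁ V i in Unit-1- (0≤x , x≤1) , uy
      lower : ∀ N → ((z : Config P q) → IsVertex P z → denConfig P z ∣ N) → seqLcm P q ∣ N
      lower N all = seqLcm-least q (record { boundary = boundary ; interior = interior })
        where
        -- The point of index `m < q` is, up to mirroring, a piece of the vertex formed by the first
        -- `q` points.
        occurring : ∀ p → (∀ m → Support a b p m) → (∀ m → Box (p m)) → ∀ m → m ℕ.< q → DenominatorsDivide N (p m)
        occurring p support box m m<q = subst (DenominatorsDivide N ∘ p) (toℕ-fromℕ< m<q)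
          (mirror-divides⁻ (p (toℕ (fromℕ< m<q))) (denConfig-divides P (config p support box q)
            (all (config p support box q) (config-isVertex p support box q)) (fromℕ< m<q)))
        coordinate : ∀ {p x} → DenominatorsDivide N p → proj₁ p ≡ x ⊎ proj₂ p ≡ x → ↧ₙ x ∣ N
        coordinate (dx , _) (inj₁ refl) = dx
        coordinate (_ , dy) (inj₂ refl) = dy
        boundary : ∀ n → n ℕ.< q → DenominatorsDivide N (ℓ a b n , ℓ b a n)
        boundary n n<q =
          coordinate (occurring (corners a b) (corners-support a b) (corners-box S) n n<q)
            (corners-coordinate a b n) ,
          coordinate (swap (occurring (swap ∘ corners b a) (corners-support′ a b)
              (swap ∘ corners-box (Slopes-swap S)) n n<q))
            (corners-coordinate b a n)
        interior : ∀ n → 1 ℕ.≤ n → suc (2 ℕ.* n) ℕ.≤ q → ∀ p →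
          line a p ≡ ℓ a b n → line b (swap p) ≡ ℓ b a n → DenominatorsDivide N p
        interior (suc n) _ 2n<q p t≡ s≡ = subst (DenominatorsDivide N) points-last
          (occurring points points-support points-box (double (suc n))
            (subst (ℕ._< q) (sym (double≡ (suc n))) 2n<q))
          where open Meeting S n p t≡ s≡

-- Slopes of the moves

⟦⟧≢0 : ∀ {i} → i ≢ ℤ.pos 0 → ⟦ i ⟧ ≢ 0ℚ
⟦⟧≢0 {i} i≢0 e = i≢0 (trans (sym (↥-/ i 1)) (cong (λ p → ↥ p Int.* Int.gcd i (Int.+ 1)) e))

opaque

  -- `b` is the reciprocal of `e = d₂ / c₂ > 1`; multiplying `b ≤ 0` or `b ≥ 1` by `e` contradicts
  -- `b * e = 1`.
  slopes : ∀ {c₁ d₁ c₂ d₂} → c₂ ≢ 0ℚ → d₂ ≢ 0ℚ →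
    0ℚ < d₁ /' c₁ → d₁ /' c₁ < 1ℚ → 1ℚ < d₂ /' c₂ → Slopes (d₁ /' c₁) (c₂ /' d₂)
  slopes {c₁} {d₁} {c₂} {d₂} c₂≢0 d₂≢0 0<a a<1 1<e = record
    { 0<a = 0<a ; a<1 = a<1
    ; 0<b = ≰⇒> λ b≤0 → <-irrefl refl (<-≤-trans 0<1 (≤-by (0≤* (<⇒≤ 0<e) (≤⇒0≤ b≤0)) (lemma₁ (c₂ /' d₂) (d₂ /' c₂) be≡1)))
    ; b<1 = ≰⇒> λ 1≤b → <-irrefl refl (<-≤-trans 1<e (≤-by (0≤* (<⇒≤ 0<e) (≤⇒0≤ 1≤b)) (lemma₂ (c₂ /' d₂) (d₂ /' c₂) be≡1)))
    }
    where
    0<e : 0ℚ < d₂ /' c₂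
    0<e = <-trans 0<1 1<e
    be≡1 : (c₂ /' d₂) * (d₂ /' c₂) ≡ 1ℚ
    be≡1 = *-cancelˡ (d₂ * c₂) (*-≢0 d₂≢0 c₂≢0) (trans (lemma d₂ c₂ (c₂ /' d₂) (d₂ /' c₂))
      (trans (cong₂ _*_ (/'-* c₂ d₂≢0) (/'-* d₂ c₂≢0)) (trans (*-comm c₂ d₂) (sym (*-identityʳ (d₂ * c₂))))))
      where
      lemma : ∀ d c b e → d * c * (b * e) ≡ b * d * (e * c)
      lemma = solve-∀ ℚ-ring
    lemma₁ : ∀ b e → b * e ≡ 1ℚ → e * (0ℚ - b) ≡ 0ℚ - 1ℚ
    lemma₁ b e h = trans (lemma b e) (cong (λ x → 0ℚ - x) h)
      where
      lemma : ∀ b e → e * (0ℚ - b) ≡ 0ℚ - b * e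
      lemma = solve-∀ ℚ-ring
    lemma₂ : ∀ b e → b * e ≡ 1ℚ → e * (b - 1ℚ) ≡ 1ℚ - e
    lemma₂ b e h = trans (lemma b e) (cong (_- e) h)
      where
      lemma : ∀ b e → e * (b - 1ℚ) ≡ b * e - e
      lemma = solve-∀ ℚ-ring

  0/' : ∀ q → 0ℚ /' q ≡ 0ℚ
  0/' q with q ≟ 0ℚ
  ... | yes _ = refl
  ... | no q≢0 = *-zeroˡ ((1/ q) {{≢-nonZero q≢0}})

theorem6p2 : (c₁ d₁ c₂ d₂ : ℤ) →
    Coprime ∣ c₁ ∣ ∣ d₁ ∣ → Coprime ∣ c₂ ∣ ∣ d₂ ∣ →
    c₁ ≢ ℤ.pos 0 → c₂ ≢ ℤ.pos 0 →
    0ℚ < ⟦ d₁ ⟧ /' ⟦ c₁ ⟧ → ⟦ d₁ ⟧ /' ⟦ c₁ ⟧ < 1ℚ → 1ℚ < ⟦ d₂ ⟧ /' ⟦ c₂ ⟧ →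
    (q : ℕ) → IsIOPDenominator (moves c₁ d₁ c₂ d₂) q (seqLcm (moves c₁ d₁ c₂ d₂) q)
theorem6p2 c₁ d₁ c₂ d₂ _ _ c₁≢0 c₂≢0 0<a a<1 1<e =
  Sequences.denominator-theorem (moves c₁ d₁ c₂ d₂) (slopes {⟦ c₁ ⟧} {⟦ d₁ ⟧} {⟦ c₂ ⟧} {⟦ d₂ ⟧} (⟦⟧≢0 c₂≢0) d₂≢0 0<a a<1 1<e)
    (⟦⟧≢0 c₁≢0) d₂≢0 (sym (/'-* ⟦ d₁ ⟧ (⟦⟧≢0 c₁≢0))) (sym (/'-* ⟦ c₂ ⟧ d₂≢0)) refl refl
  where
  d₂≢0 : ⟦ d₂ ⟧ ≢ 0ℚ
  -- Were `d₂` zero, the quotient `d₂ / c₂` would be zero and not above `1`.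
  d₂≢0 e = <-asym 0<1 (subst (1ℚ <_) (trans (cong (_/' ⟦ c₂ ⟧) e) (0/' ⟦ c₂ ⟧)) 1<e)
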